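{- Let $P, Q \subseteq \mathbb{R}^d$ be semi-rational polytopes, each of codimension $0$ or $1$. Suppose that $L_{P+w}(s) = L_{Q+w}(s)$ for all integer vectors $w \in \mathbb{Z}^d$ and all real $s > 0$. Then $P = Q$.
   Context: For a polytope $P \subseteq \mathbb{R}^d$ and real $s \ge 0$, the real Ehrhart function is $L_P(s) = \#(sP \cap \mathbb{Z}^d)$, where $sP = \{sx : x \in P\}$. A polytope $P \subseteq \mathbb{R}^d$ is semi-rational if it can be written as $P = \bigcap_{i=1}^n \{x \in \mathbb{R}^d : \langle a_i, x\rangle \le b_i\}$ with all $a_i \in \mathbb{Z}^d$ and all $b_i \in \mathbb{R}$ arbitrary. -}

module Defs where

open import Algebra.Bundles using (CommutativeRing)
open import Algebra.Structures using (IsCommutativeRing)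
open import Axiom.ExcludedMiddle using (ExcludedMiddle)
open import Data.Fin.Base using (Fin)
open import Data.Integer.Base using (ℤ; +_; -[1+_])
open import Data.List.Base using (List; length)
open import Data.List.Membership.Propositional using (_∈_)
open import Data.List.Relation.Unary.Unique.Propositional using (Unique)
open import Data.Nat.Base as ℕ using (ℕ; suc)
open import Data.Product.Base using (∃; ∃₂; _×_; _,_)
open import Data.Vec.Base as Vec using (Vec)
open import Data.Vec.Functional using (Vector; map; zipWith)
open import Function.Bundles using (_⇔_)
open import Level using (0ℓ)
open import Relation.Binary.Core using (Rel)
open import Relation.Binary.PropositionalEquality.Core using (_≡_)
open import Relation.Binary.Structures using (IsTotalOrder)
open import Relation.Nullary using (¬_; yes; no)
open import Relation.Unary using (Pred; _≐_)
import Algebra.Definitions.RawMonoid as RawMonoidDefinitions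
import Data.Vec.Functional.Relation.Binary.Equality.Setoid as VectorEquality
import Relation.Binary.Construct.NonStrictToStrict as NonStrictToStrict

IsUpperBound : {A : Set} → Rel A 0ℓ → Pred A 0ℓ → Pred A 0ℓ
IsUpperBound _≤_ S u = ∀ x → S x → x ≤ u

IsSupremum : {A : Set} → Rel A 0ℓ → Pred A 0ℓ → Pred A 0ℓ
IsSupremum _≤_ S u = IsUpperBound _≤_ S u × (∀ v → IsUpperBound _≤_ S v → u ≤ v)

-- The library has no real numbers.  They are characterised axiomatically, as
-- a Dedekind-complete totally ordered field; classically there is exactly one
-- up to isomorphism.
record CompleteOrderedField : Set₁ where
  infixl 7 _*_
  infixl 6 _+_
  infix  8 -_
  infix  4 _≈_ _≤_
  field
    Carrier           : Set
    _≈_ _≤_           : Rel Carrier 0ℓ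
    _+_ _*_           : Carrier → Carrier → Carrier
    -_                : Carrier → Carrier
    0# 1#             : Carrier
    isCommutativeRing : IsCommutativeRing _≈_ _+_ _*_ -_ 0# 1#
    isTotalOrder      : IsTotalOrder _≈_ _≤_
    0#≉1#             : ¬ (0# ≈ 1#)
    inverse           : ∀ x → ¬ (x ≈ 0#) → ∃ λ y → x * y ≈ 1#
    +-monoˡ-≤         : ∀ z {x y} → x ≤ y → x + z ≤ y + z
    *-nonNegative     : ∀ {x y} → 0# ≤ x → 0# ≤ y → 0# ≤ x * y
    supremum          : (S : Pred Carrier 0ℓ) → ∃ S → ∃ (IsUpperBound _≤_ S) →
                        ∃ (IsSupremum _≤_ S)

  commutativeRing : CommutativeRing 0ℓ 0ℓ
  commutativeRing = record { isCommutativeRing = isCommutativeRing }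

  open CommutativeRing commutativeRing public
    using (setoid; +-rawMonoid)

  open NonStrictToStrict _≈_ _≤_ public using (_<_)

HasCardinality : {A : Set} → Pred A 0ℓ → ℕ → Set
HasCardinality {A} S n =
  ∃ λ (xs : List A) → Unique xs × (∀ x → (x ∈ xs) ⇔ S x) × length xs ≡ n

-- The cardinality of a finite set.  The value 0 on infinite sets is a
-- convention only.
card : ExcludedMiddle 0ℓ → {A : Set} → Pred A 0ℓ → ℕ
card em S with em {∃ (HasCardinality S)}
... | yes (n , _) = n
... | no  _       = 0

module Geometry (ℝ : CompleteOrderedField) where

  open CompleteOrderedField ℝ
  open RawMonoidDefinitions +-rawMonoid using (sum) renaming (_×_ to _·_)
  open VectorEquality setoid using (_≋_)

  ℝ^_ : ℕ → Set
  ℝ^ d = Vector Carrier d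

  fromℤ : ℤ → Carrier
  fromℤ (+ n)    = n · 1#
  fromℤ -[1+ n ] = - (suc n · 1#)

  fromℤ^ : ∀ {d} → Vec ℤ d → ℝ^ d
  fromℤ^ z i = fromℤ (Vec.lookup z i)

  infixl 6 _⊕_ _+ᵖ_
  infixr 7 _⊛_ _*ᵖ_

  _⊕_ : ∀ {d} → ℝ^ d → ℝ^ d → ℝ^ d
  _⊕_ = zipWith _+_

  _⊛_ : ∀ {d} → Carrier → ℝ^ d → ℝ^ d
  s ⊛ x = map (s *_) x

  ⟨_,_⟩ : ∀ {d} → ℝ^ d → ℝ^ d → Carrier
  ⟨ x , y ⟩ = sum (zipWith _*_ x y)

  combination : ∀ {d m} → Vector Carrier m → Vector (ℝ^ d) m → ℝ^ d
  combination c p j = sum (λ i → c i * p i j)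

  Subset : ℕ → Set₁
  Subset d = Pred (ℝ^ d) 0ℓ

  _*ᵖ_ : ∀ {d} → Carrier → Subset d → Subset d
  (s *ᵖ P) y = ∃ λ x → P x × y ≋ s ⊛ x

  _+ᵖ_ : ∀ {d} → Subset d → ℝ^ d → Subset d
  (P +ᵖ w) y = ∃ λ x → P x × y ≋ x ⊕ w

  halfspaces : ∀ {d n} → Vector (ℝ^ d) n → Vector Carrier n → Subset d
  halfspaces a b x = ∀ i → ⟨ a i , x ⟩ ≤ b i

  IsBounded : ∀ {d} → Subset d → Set
  IsBounded P = ∃ λ B → ∀ x → P x → ∀ i → - B ≤ x i × x i ≤ B

  IsPolytope : ∀ {d} → Subset d → Set
  IsPolytope {d} P = IsBounded P ×
    ∃ λ n → ∃₂ λ (a : Vector (ℝ^ d) n) b → P ≐ halfspaces a b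

  IsSemiRational : ∀ {d} → Subset d → Set
  IsSemiRational {d} P =
    ∃ λ n → ∃₂ λ (a : Vector (Vec ℤ d) n) b → P ≐ halfspaces (map fromℤ^ a) b

  affineHull : ∀ {d} → Subset d → Subset d
  affineHull {d} S x =
    ∃ λ m → ∃₂ λ (c : Vector Carrier m) (p : Vector (ℝ^ d) m) →
      (∀ i → S (p i)) × sum c ≈ 1# × x ≋ combination c p

  range : ∀ {d m} → Vector (ℝ^ d) m → Subset d
  range p x = ∃ λ i → x ≋ p i

  AffinelyIndependent : ∀ {d m} → Vector (ℝ^ d) m → Set
  AffinelyIndependent p = ∀ c → sum c ≈ 0# →
    combination c p ≋ (λ _ → 0#) → ∀ i → c i ≈ 0#

  -- The dimension of P is that of its affine hull: one less than the size m of
  -- an affine basis of the hull.  Hence codim P = d - (m - 1), written without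
  -- subtraction.  The empty set (m = 0) has dimension -1.
  HasCodimension : ∀ {d} → Subset d → ℕ → Set
  HasCodimension {d} P k = ∃ λ m → ∃ λ (p : Vector (ℝ^ d) m) →
    AffinelyIndependent p × affineHull P ≐ affineHull (range p) ×
    m ℕ.+ k ≡ suc d

  latticePoints : ∀ {d} → Subset d → Pred (Vec ℤ d) 0ℓ
  latticePoints P z = P (fromℤ^ z)

  ehrhart : ExcludedMiddle 0ℓ → ∀ {d} → Subset d → Carrier → ℕ
  ehrhart em P s = card em (latticePoints (s *ᵖ P))

{-# OPTIONS --safe #-}
module Submission where

-- A point y = w + ρ z with w, z ∈ ℤᵈ and ρ real is also (w - K z) + (ρ + K) z
-- for every integer K.  For large r = ρ + K, a bounded set meets the affine
-- lattice (w - K z) + r ℤᵈ at most once, so the Ehrhart function of its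
-- translate by -(w - K z), evaluated at 1 / r, is 0 or 1 and decides whether
-- the set contains y.  Hence P and Q contain the same points w + ρ z.
--
-- Such points are dense in every hyperplane ⟨a,x⟩ = b with a integral.  If P
-- had a point outside a half-space containing Q, then so would it have a point
-- c of its relative interior.  Since P has codimension at most 1, its
-- constraints that are not strict at c are multiples of a single ⟨a,x⟩ = b, so
-- a point w + ρ z of this hyperplane close to c lies in P but not in Q.

open import Algebra.Bundles using (CommutativeRing)
open import Algebra.Solver.Ring.AlmostCommutativeRing using (fromCommutativeRing; _-Raw-AlmostCommutative⟶_)
open import Axiom.ExcludedMiddle using (ExcludedMiddle)
open import Data.Fin.Base using (Fin; zero; suc; punchIn; punchOut)
open import Data.Fin.Properties as Fin using (punchInᵢ≢i; punchOut-injective; punchIn-punchOut)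
open import Data.Integer.Base as ℤ using (ℤ; +_; -[1+_])
import Data.Integer.Properties as ℤ
open import Data.List.Base using ([]; _∷_)
open import Data.List.Relation.Unary.All using ([])
open import Data.List.Relation.Unary.AllPairs using ([]; _∷_)
open import Data.List.Relation.Unary.Any using (here)
open import Data.Maybe.Base using (map)
open import Data.Nat.Base as ℕ using (ℕ; zero; suc)
import Data.Nat.Properties as ℕ
open import Data.Product.Base using (∃; _×_; _,_; proj₁; proj₂)
open import Data.Sum.Base using (_⊎_; inj₁; inj₂; [_,_]′)
open import Data.Vec.Base as Vec using (Vec; []; _∷_; tabulate)
open import Data.Vec.Functional as Vector using (Vector; head; tail; insertAt; removeAt; updateAt)
open import Data.Vec.Functional.Properties using (insertAt-punchIn; updateAt-updates; updateAt-minimal)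
open import Data.Vec.Properties using (lookup∘tabulate; tabulate∘lookup; tabulate-cong)
open import Function.Bundles using (Equivalence; mk⇔)
open import Level using (0ℓ)
open import Relation.Binary.PropositionalEquality.Core as ≡ using (_≡_; _≢_)
open import Relation.Binary.Structures using (IsTotalOrder)
open import Relation.Nullary using (¬_; yes; no; contradiction)
open import Relation.Nullary.Decidable.Core using (dec⇒maybe; decidable-stable)
open import Relation.Unary using (Pred; _≐_; _⊆_)
open import Defs
import Algebra.Properties.CommutativeSemigroup as CommutativeSemigroupProperties
import Algebra.Properties.Ring as RingProperties
import Algebra.Properties.Semiring.Mult as Mult
import Algebra.Properties.Semiring.Sum as Sum
import Algebra.Solver.Ring as RingSolver
import Data.Vec.Functional.Relation.Binary.Equality.Setoid as VectorEquality
import Relation.Binary.Construct.NonStrictToStrict as NonStrictToStrict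
import Relation.Binary.Reasoning.Setoid as SetoidReasoning

module _ (em : ExcludedMiddle 0ℓ) (ℝ : CompleteOrderedField) where

  open CompleteOrderedField ℝ
  open Geometry ℝ
  open CommutativeRing commutativeRing
    using (refl; sym; trans; +-cong; +-congˡ; +-congʳ; *-cong; *-congˡ; *-congʳ; -‿cong
          ; +-identityˡ; +-identityʳ; *-identityˡ; *-identityʳ; +-comm; *-comm; -‿inverseʳ
          ; zeroˡ; zeroʳ; semiring; ring; reflexive; +-commutativeSemigroup)
  open RingProperties ring using (-0#≈0#; -‿involutive; -‿distribˡ-*; -‿distribʳ-*; -‿+-comm)
  open CommutativeSemigroupProperties +-commutativeSemigroup using (interchange)
  open Mult semiring using (×-homo-+; ×1-homo-*) renaming (_×_ to _·_)
  open Sum semiring using (sum; sum-cong-≋; sum-replicate-zero; sum-remove)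
  open VectorEquality setoid using (_≋_)
  open SetoidReasoning setoid
  open IsTotalOrder isTotalOrder using (antisym; total)
    renaming (refl to ≤-refl; reflexive to ≤-reflexive; trans to ≤-trans)

  -- The embedding of the integers as a ring homomorphism, and the ring solver.

  fromℤ-⊖ : ∀ m n → fromℤ (m ℤ.⊖ n) ≈ m · 1# + - (n · 1#)
  fromℤ-⊖ m       zero    = sym (trans (+-congˡ -0#≈0#) (+-identityʳ _))
  fromℤ-⊖ zero    (suc n) = sym (+-identityˡ _)
  fromℤ-⊖ (suc m) (suc n) = begin
    fromℤ (suc m ℤ.⊖ suc n)               ≡⟨ ≡.cong fromℤ (ℤ.[1+m]⊖[1+n]≡m⊖n m n) ⟩
    fromℤ (m ℤ.⊖ n)                       ≈⟨ fromℤ-⊖ m n ⟩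
    m · 1# + - (n · 1#)                   ≈⟨ +-identityˡ _ ⟨
    0# + (m · 1# + - (n · 1#))            ≈⟨ +-congʳ (-‿inverseʳ 1#) ⟨
    1# + - 1# + (m · 1# + - (n · 1#))     ≈⟨ interchange _ _ _ _ ⟩
    suc m · 1# + (- 1# + - (n · 1#))      ≈⟨ +-congˡ (-‿+-comm _ _) ⟩
    suc m · 1# + - (suc n · 1#)           ∎

  fromℤ-neg : ∀ i → fromℤ (ℤ.- i) ≈ - fromℤ i
  fromℤ-neg (+ zero)  = sym -0#≈0#
  fromℤ-neg (+ suc n) = refl
  fromℤ-neg -[1+ n ]  = sym (-‿involutive _)

  fromℤ-+ : ∀ i j → fromℤ (i ℤ.+ j) ≈ fromℤ i + fromℤ j
  fromℤ-+ (+ m)    (+ n)    = ×-homo-+ 1# m n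
  fromℤ-+ (+ m)    -[1+ n ] = fromℤ-⊖ m (suc n)
  fromℤ-+ -[1+ m ] (+ n)    = trans (fromℤ-⊖ n (suc m)) (+-comm _ _)
  fromℤ-+ -[1+ m ] -[1+ n ] = begin
    - (suc (suc (m ℕ.+ n)) · 1#)           ≡⟨ ≡.cong (λ k → - (suc k · 1#)) (ℕ.+-suc m n) ⟨
    - ((suc m ℕ.+ suc n) · 1#)             ≈⟨ -‿cong (×-homo-+ 1# (suc m) (suc n)) ⟩
    - (suc m · 1# + suc n · 1#)            ≈⟨ -‿+-comm _ _ ⟨
    - (suc m · 1#) + - (suc n · 1#)        ∎

  fromℤ-pos-* : ∀ m j → fromℤ (+ m ℤ.* j) ≈ fromℤ (+ m) * fromℤ j
  fromℤ-pos-* m (+ n) = trans (reflexive (≡.cong fromℤ (≡.sym (ℤ.pos-* m n)))) (×1-homo-* m n)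
  fromℤ-pos-* m -[1+ n ] = begin
    fromℤ (+ m ℤ.* ℤ.- (+ suc n))      ≡⟨ ≡.cong fromℤ (ℤ.neg-distribʳ-* (+ m) (+ suc n)) ⟨
    fromℤ (ℤ.- (+ m ℤ.* + suc n))      ≈⟨ fromℤ-neg (+ m ℤ.* + suc n) ⟩
    - fromℤ (+ m ℤ.* + suc n)          ≈⟨ -‿cong (fromℤ-pos-* m (+ suc n)) ⟩
    - (fromℤ (+ m) * fromℤ (+ suc n))  ≈⟨ -‿distribʳ-* _ _ ⟩
    fromℤ (+ m) * fromℤ -[1+ n ]       ∎

  fromℤ-* : ∀ i j → fromℤ (i ℤ.* j) ≈ fromℤ i * fromℤ j
  fromℤ-* (+ m)    j = fromℤ-pos-* m j
  fromℤ-* -[1+ m ] j = begin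
    fromℤ (ℤ.- (+ suc m) ℤ.* j)        ≡⟨ ≡.cong fromℤ (ℤ.neg-distribˡ-* (+ suc m) j) ⟨
    fromℤ (ℤ.- (+ suc m ℤ.* j))        ≈⟨ fromℤ-neg (+ suc m ℤ.* j) ⟩
    - fromℤ (+ suc m ℤ.* j)            ≈⟨ -‿cong (fromℤ-pos-* (suc m) j) ⟩
    - (fromℤ (+ suc m) * fromℤ j)      ≈⟨ -‿distribˡ-* _ _ ⟩
    fromℤ -[1+ m ] * fromℤ j           ∎

  -- The image of 1 under fromℤ is 1# + 0#, whereas the constant 1 of a solver
  -- equation should be 1# on the nose.
  ⟦_⟧ : ℤ → Carrier
  ⟦ + 1 ⟧ = 1#
  ⟦ i   ⟧ = fromℤ i

  ⟦⟧≈fromℤ : ∀ i → ⟦ i ⟧ ≈ fromℤ i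
  ⟦⟧≈fromℤ (+ 0)           = refl
  ⟦⟧≈fromℤ (+ 1)           = sym (+-identityʳ 1#)
  ⟦⟧≈fromℤ (+ suc (suc n)) = refl
  ⟦⟧≈fromℤ -[1+ n ]        = refl

  ⟦⟧-homomorphism : ℤ.+-*-rawRing -Raw-AlmostCommutative⟶ fromCommutativeRing commutativeRing
  ⟦⟧-homomorphism = record
    { ⟦_⟧    = ⟦_⟧
    ; +-homo = λ i j → trans (⟦⟧≈fromℤ (i ℤ.+ j)) (trans (fromℤ-+ i j)
                 (sym (+-cong (⟦⟧≈fromℤ i) (⟦⟧≈fromℤ j))))
    ; *-homo = λ i j → trans (⟦⟧≈fromℤ (i ℤ.* j)) (trans (fromℤ-* i j)
                 (sym (*-cong (⟦⟧≈fromℤ i) (⟦⟧≈fromℤ j))))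
    ; -‿homo = λ i → trans (⟦⟧≈fromℤ (ℤ.- i)) (trans (fromℤ-neg i)
                 (sym (-‿cong (⟦⟧≈fromℤ i))))
    ; 0-homo = refl
    ; 1-homo = refl
    }

  open RingSolver ℤ.+-*-rawRing (fromCommutativeRing commutativeRing) ⟦⟧-homomorphism
    (λ i j → map (λ eq → reflexive (≡.cong ⟦_⟧ eq)) (dec⇒maybe (i ℤ.≟ j)))
    using (solve; _:+_; _:*_; :-_; _:=_; con)

  -- Order arithmetic in the field.

  -- The standard way to prove an inequality below: exhibit a nonnegative slack `t` and leave the
  -- identity `x + t ≈ y` to the ring solver.
  ≤-from : ∀ {x y t} → 0# ≤ t → x + t ≈ y → x ≤ y
  ≤-from {x} {y} {t} 0≤t x+t≈y = ≤-trans (≤-reflexive (sym (+-identityˡ x)))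
    (≤-trans (+-monoˡ-≤ x 0≤t) (≤-reflexive (trans (+-comm t x) x+t≈y)))

  ≤⇒0≤ : ∀ {x y} → x ≤ y → 0# ≤ y + - x
  ≤⇒0≤ {x} x≤y = ≤-trans (≤-reflexive (sym (-‿inverseʳ x))) (+-monoˡ-≤ (- x) x≤y)

  0≤⇒≤ : ∀ {x y} → 0# ≤ y + - x → x ≤ y
  0≤⇒≤ {x} {y} 0≤t = ≤-from 0≤t (solve 2 (λ x y → x :+ (y :+ :- x) := y) refl x y)

  ≤-resp : ∀ {x x′ y y′} → x ≈ x′ → y ≈ y′ → x ≤ y → x′ ≤ y′
  ≤-resp x≈ y≈ x≤y = ≤-trans (≤-reflexive (sym x≈)) (≤-trans x≤y (≤-reflexive y≈))

  <-resp : ∀ {x x′ y y′} → x ≈ x′ → y ≈ y′ → x < y → x′ < y′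
  <-resp x≈ y≈ (x≤y , x≉y) = ≤-resp x≈ y≈ x≤y , λ x′≈y′ → x≉y (trans x≈ (trans x′≈y′ (sym y≈)))

  <⇒0< : ∀ {x y} → x < y → 0# < y + - x
  <⇒0< {x} {y} (x≤y , x≉y) = ≤⇒0≤ x≤y , λ 0≈t → x≉y (sym (begin
    y            ≈⟨ solve 2 (λ x y → y := y :+ :- x :+ x) refl x y ⟩
    y + - x + x  ≈⟨ +-congʳ 0≈t ⟨
    0# + x       ≈⟨ +-identityˡ x ⟩
    x            ∎))

  0<⇒< : ∀ {x y} → 0# < y + - x → x < y
  0<⇒< {x} (0≤t , 0≉t) = 0≤⇒≤ 0≤t , λ x≈y →
    0≉t (trans (sym (-‿inverseʳ x)) (+-congʳ x≈y))

  <⇒≱ : ∀ {x y} → x < y → ¬ (y ≤ x)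
  <⇒≱ = NonStrictToStrict.<⇒≱ _≈_ _≤_ antisym

  ≰⇒> : ∀ {x y} → ¬ (x ≤ y) → y < x
  ≰⇒> = NonStrictToStrict.≰⇒> _≈_ _≤_ sym ≤-reflexive total

  ≤-<-trans : ∀ {x y z} → x ≤ y → y < z → x < z
  ≤-<-trans x≤y y<z = ≰⇒> λ z≤x → <⇒≱ y<z (≤-trans z≤x x≤y)

  <-≤-trans : ∀ {x y z} → x < y → y ≤ z → x < z
  <-≤-trans x<y y≤z = ≰⇒> λ z≤x → <⇒≱ x<y (≤-trans y≤z z≤x)

  +-nonNeg : ∀ {x y} → 0# ≤ x → 0# ≤ y → 0# ≤ x + y
  +-nonNeg {x} {y} 0≤x 0≤y = ≤-trans 0≤x (≤-from 0≤y refl)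

  +-pos-nonNeg : ∀ {x y} → 0# < x → 0# ≤ y → 0# < x + y
  +-pos-nonNeg 0<x 0≤y = <-≤-trans 0<x (≤-from 0≤y refl)

  neg-nonNeg : ∀ {x} → x ≤ 0# → 0# ≤ - x
  neg-nonNeg {x} x≤0 = ≤-resp refl (+-identityˡ (- x)) (≤⇒0≤ x≤0)

  *-pos : ∀ {x y} → 0# < x → 0# < y → 0# < x * y
  *-pos {x} {y} (0≤x , 0≉x) (0≤y , 0≉y) = *-nonNegative 0≤x 0≤y , λ 0≈xy →
    let x⁻¹ , x*x⁻¹≈1 = inverse x (λ x≈0 → 0≉x (sym x≈0)) in 0≉y (begin
      0#             ≈⟨ zeroʳ x⁻¹ ⟨
      x⁻¹ * 0#       ≈⟨ *-congˡ 0≈xy ⟩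
      x⁻¹ * (x * y)  ≈⟨ solve 3 (λ x y z → z :* (x :* y) := x :* z :* y) refl x y x⁻¹ ⟩
      x * x⁻¹ * y    ≈⟨ *-congʳ x*x⁻¹≈1 ⟩
      1# * y         ≈⟨ *-identityˡ y ⟩
      y              ∎)

  *-cancelˡ-pos : ∀ {x y} → 0# < x → 0# < x * y → 0# < y
  *-cancelˡ-pos {x} {y} (0≤x , _) 0<xy = ≰⇒> λ y≤0 → <⇒≱ 0<xy
    (≤-from (*-nonNegative 0≤x (neg-nonNeg y≤0)) (solve 2 (λ x y → x :* y :+ x :* :- y := con (+ 0)) refl x y))

  *-cancelˡ-nonNeg : ∀ {x y} → 0# < x → 0# ≤ x * y → 0# ≤ y
  *-cancelˡ-nonNeg {x} {y} 0<x 0≤xy with total 0# y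
  ... | inj₁ 0≤y = 0≤y
  ... | inj₂ y≤0 with em {0# ≈ y}
  ...   | yes 0≈y = ≤-reflexive 0≈y
  ...   | no  0≉y = contradiction 0≤xy (<⇒≱ (0<⇒< (<-resp refl
          (solve 2 (λ x y → x :* (con (+ 0) :+ :- y) := con (+ 0) :+ :- (x :* y)) refl x y)
          (*-pos 0<x (<⇒0< (y≤0 , λ y≈0 → 0≉y (sym y≈0)))))))

  0<1 : 0# < 1#
  0<1 with total 0# 1#
  ... | inj₁ 0≤1 = 0≤1 , 0#≉1#
  -- Even here 1 is nonnegative, being the square of -1.
  ... | inj₂ 1≤0 = ≤-resp refl (solve 0 (:- con (+ 1) :* :- con (+ 1) := con (+ 1)) refl)
                     (*-nonNegative (neg-nonNeg 1≤0) (neg-nonNeg 1≤0)) , 0#≉1#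

  positive⇒invertible : ∀ {x} → 0# < x → ∃ λ y → 0# < y × x * y ≈ 1#
  positive⇒invertible {x} 0<x@(_ , 0≉x) =
    let y , x*y≈1 = inverse x (λ x≈0 → 0≉x (sym x≈0))
    in  y , *-cancelˡ-pos 0<x (<-resp refl (sym x*y≈1) 0<1) , x*y≈1

  *-zero-divisorˡ : ∀ {x y} → ¬ (x ≈ 0#) → x * y ≈ 0# → y ≈ 0#
  *-zero-divisorˡ {x} {y} x≉0 xy≈0 = let x⁻¹ , x*x⁻¹≈1 = inverse x x≉0 in begin
    y              ≈⟨ *-identityˡ y ⟨
    1# * y         ≈⟨ *-congʳ x*x⁻¹≈1 ⟨
    x * x⁻¹ * y    ≈⟨ solve 3 (λ x y z → x :* z :* y := z :* (x :* y)) refl x y x⁻¹ ⟩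
    x⁻¹ * (x * y)  ≈⟨ *-congˡ xy≈0 ⟩
    x⁻¹ * 0#       ≈⟨ zeroʳ x⁻¹ ⟩
    0#             ∎

  -- Bounds on absolute values.

  -- This is |x| ≤ b, written as two inequalities so that no absolute value has to be defined.
  Bounded : Carrier → Pred Carrier 0ℓ
  Bounded b x = - b ≤ x × x ≤ b

  Bounded-resp : ∀ {b b′ x x′} → b ≈ b′ → x ≈ x′ → Bounded b x → Bounded b′ x′
  Bounded-resp b≈ x≈ (l , u) = ≤-resp (-‿cong b≈) x≈ l , ≤-resp x≈ b≈ u

  Bounded-mono : ∀ {b b′ x} → b ≤ b′ → Bounded b x → Bounded b′ x
  Bounded-mono {b} {b′} b≤b′ (l , u) =
    ≤-trans (≤-from (≤⇒0≤ b≤b′) (solve 2 (λ b b′ → :- b′ :+ (b′ :+ :- b) := :- b) refl b b′)) l , ≤-trans u b≤b′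

  Bounded-neg : ∀ {b x} → Bounded b x → Bounded b (- x)
  Bounded-neg {b} {x} (l , u) =
    ≤-from (≤⇒0≤ u) (solve 2 (λ b x → :- b :+ (b :+ :- x) := :- x) refl b x) ,
    ≤-from (≤⇒0≤ l) (solve 2 (λ b x → :- x :+ (x :+ :- :- b) := b) refl b x)

  Bounded-+ : ∀ {b c x y} → Bounded b x → Bounded c y → Bounded (b + c) (x + y)
  Bounded-+ {b} {c} {x} {y} (l , u) (l′ , u′) =
    ≤-from (+-nonNeg (≤⇒0≤ l) (≤⇒0≤ l′))
      (solve 4 (λ b c x y → :- (b :+ c) :+ (x :+ :- :- b :+ (y :+ :- :- c)) := x :+ y) refl b c x y) ,
    ≤-from (+-nonNeg (≤⇒0≤ u) (≤⇒0≤ u′))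
      (solve 4 (λ b c x y → x :+ y :+ (b :+ :- x :+ (c :+ :- y)) := b :+ c) refl b c x y)

  Bounded-scale : ∀ {c b x} → 0# ≤ c → Bounded b x → Bounded (c * b) (c * x)
  Bounded-scale {c} {b} {x} 0≤c (l , u) =
    ≤-from (*-nonNegative 0≤c (≤⇒0≤ l))
      (solve 3 (λ c b x → :- (c :* b) :+ c :* (x :+ :- :- b) := c :* x) refl c b x) ,
    ≤-from (*-nonNegative 0≤c (≤⇒0≤ u))
      (solve 3 (λ c b x → c :* x :+ c :* (b :+ :- x) := c :* b) refl c b x)

  ∃-Bounded-* : ∀ c → ∃ λ k → 0# ≤ k × (∀ {b x} → Bounded b x → Bounded (k * b) (c * x))
  ∃-Bounded-* c with total 0# c
  ... | inj₁ 0≤c = c , 0≤c , Bounded-scale 0≤c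
  ... | inj₂ c≤0 = - c , neg-nonNeg c≤0 , λ {b} {x} bounded → Bounded-resp refl
          (solve 2 (λ c x → :- (:- c :* x) := c :* x) refl c x)
          (Bounded-neg (Bounded-scale (neg-nonNeg c≤0) bounded))

  ∃-Bounded : ∀ x → ∃ λ b → 0# ≤ b × Bounded b x
  ∃-Bounded x with total 0# x
  ... | inj₁ 0≤x = x , 0≤x , ≤-from (+-nonNeg 0≤x 0≤x) (solve 1 (λ x → :- x :+ (x :+ x) := x) refl x) , ≤-refl
  ... | inj₂ x≤0 = - x , 0≤-x , ≤-reflexive (-‿involutive x) ,
          ≤-from (+-nonNeg 0≤-x 0≤-x) (solve 1 (λ x → x :+ (:- x :+ :- x) := :- x) refl x)
    where 0≤-x = neg-nonNeg x≤0

  -- Take δ = g / (1 + k); the added 1 covers k = 0 without a case distinction.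
  ∃-scale< : ∀ {k g} → 0# ≤ k → 0# < g → ∃ λ δ → 0# < δ × k * δ < g
  ∃-scale< {k} {g} 0≤k 0<g =
    let 1/[1+k] , 0<1/[1+k] , inv = positive⇒invertible (+-pos-nonNeg 0<1 0≤k)
        0<δ = *-pos 0<g 0<1/[1+k]
    in  g * 1/[1+k] , 0<δ , 0<⇒< (<-resp refl (begin
          g * 1/[1+k]
            ≈⟨ solve 3 (λ k g v → g :* v := g :* ((con (+ 1) :+ k) :* v) :+ :- (k :* (g :* v))) refl k g 1/[1+k] ⟩
          g * ((1# + k) * 1/[1+k]) + - (k * (g * 1/[1+k]))
            ≈⟨ +-congʳ (trans (*-congˡ inv) (*-identityʳ g)) ⟩
          g + - (k * (g * 1/[1+k]))                                ∎) 0<δ)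

  -- The Archimedean property and rounding to integers.

  -- Otherwise the naturals are bounded and have a supremum u. Since n + 1 ≤ u for every n, the
  -- smaller number u - 1 is an upper bound as well.
  archimedean : ∀ x → ∃ λ n → x < n · 1#
  archimedean x with em {∃ λ n → x < n · 1#}
  ... | yes found = found
  ... | no  none  = contradiction (least (u + - 1#) u-1-bound) (<⇒≱ u-1<u)
    where
    IsNatural : Pred Carrier 0ℓ
    IsNatural y = ∃ λ n → y ≈ n · 1#
    x-bound : IsUpperBound _≤_ IsNatural x
    x-bound y (n , y≈n) with em {y ≤ x}
    ... | yes y≤x = y≤x
    ... | no  y≰x = contradiction (n , <-resp refl y≈n (≰⇒> y≰x)) none
    sup   = supremum IsNatural (0# , 0 , refl) (x , x-bound)
    u     = proj₁ sup
    upper = proj₁ (proj₂ sup)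
    least = proj₂ (proj₂ sup)
    u-1-bound : IsUpperBound _≤_ IsNatural (u + - 1#)
    u-1-bound y (n , y≈n) = 0≤⇒≤ (≤-resp refl
      (solve 2 (λ u y → u :+ :- (con (+ 1) :+ y) := u :+ :- con (+ 1) :+ :- y) refl u y)
      (≤⇒0≤ (upper (1# + y) (suc n , +-congˡ y≈n))))
    u-1<u : u + - 1# < u
    u-1<u = 0<⇒< (<-resp refl (solve 1 (λ u → con (+ 1) := u :+ :- (u :+ :- con (+ 1))) refl u) 0<1)

  archimedean-+ : ∀ y x → ∃ λ n → x < y + n · 1#
  archimedean-+ y x = let n , x-y<n = archimedean (x + - y) in n , 0<⇒< (<-resp refl
    (solve 3 (λ x y n → n :+ :- (x :+ :- y) := y :+ n :+ :- x) refl x y (n · 1#)) (<⇒0< x-y<n))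

  -- Subtract 1 until at most 1 is left; the bound `n` makes the recursion terminate. The result
  -- need not be the nearest integer, an error of at most 1 is enough.
  round-nonNeg : ∀ n x → 0# ≤ x → x ≤ n · 1# → ∃ λ m → Bounded 1# (x + - (m · 1#))
  round-nonNeg n x 0≤x x≤n with total x 1#
  ... | inj₁ x≤1 = 0 , Bounded-resp refl (solve 1 (λ x → x := x :+ :- con (+ 0)) refl x)
                     (≤-from (+-nonNeg (proj₁ 0<1) 0≤x) (solve 1 (λ x → :- con (+ 1) :+ (con (+ 1) :+ x)
                           := x) refl x) , x≤1)
  round-nonNeg zero    x 0≤x x≤0 | inj₂ 1≤x = contradiction (≤-trans 1≤x x≤0) (<⇒≱ 0<1)
  round-nonNeg (suc n) x 0≤x x≤1+n | inj₂ 1≤x =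
    let m , bounded = round-nonNeg n (x + - 1#) (≤⇒0≤ 1≤x)
          (0≤⇒≤ (≤-resp refl (solve 2 (λ n x → con (+ 1) :+ n :+ :- x := n :+ :- (x :+ :- con (+ 1))) refl (n · 1#) x)
            (≤⇒0≤ x≤1+n)))
    in  suc m , Bounded-resp refl
          (solve 2 (λ m x → x :+ :- con (+ 1) :+ :- m := x :+ :- (con (+ 1) :+ m)) refl (m · 1#) x) bounded

  round : ∀ x → ∃ λ i → Bounded 1# (x + - fromℤ i)
  round x with total 0# x
  ... | inj₁ 0≤x = let n , x<n = archimedean x
                       m , bounded = round-nonNeg n x 0≤x (proj₁ x<n)
                   in  + m , bounded
  ... | inj₂ x≤0 = let n , -x<n = archimedean (- x)
                       m , bounded = round-nonNeg n (- x) (neg-nonNeg x≤0) (proj₁ -x<n)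
                   in  ℤ.- (+ m) , Bounded-resp refl (begin
                         - (- x + - (m · 1#))
                           ≈⟨ solve 2 (λ x m → :- (:- x :+ :- m) := x :+ :- :- m) refl x (m · 1#) ⟩
                         x + - - fromℤ (+ m)     ≈⟨ +-congˡ (-‿cong (fromℤ-neg (+ m))) ⟨
                         x + - fromℤ (ℤ.- (+ m)) ∎) (Bounded-neg bounded)

  -- Bilinearity of the inner product and finite sums.

  ⟨⟩-congˡ : ∀ {d} {a x y : ℝ^ d} → x ≋ y → ⟨ a , x ⟩ ≈ ⟨ a , y ⟩
  ⟨⟩-congˡ x≋y = sum-cong-≋ (λ l → *-congˡ (x≋y l))

  ⟨⟩-comm : ∀ {d} (a x : ℝ^ d) → ⟨ a , x ⟩ ≈ ⟨ x , a ⟩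
  ⟨⟩-comm a x = sum-cong-≋ (λ l → *-comm (a l) (x l))

  ⟨⟩-linearʳ : ∀ {d} (a x : ℝ^ d) t e → ⟨ a , x ⊕ t ⊛ e ⟩ ≈ ⟨ a , x ⟩ + t * ⟨ a , e ⟩
  ⟨⟩-linearʳ {zero}  a x t e = solve 1 (λ t → con (+ 0) := con (+ 0) :+ t :* con (+ 0)) refl t
  ⟨⟩-linearʳ {suc d} a x t e = trans (+-congˡ (⟨⟩-linearʳ (tail a) (tail x) t (tail e)))
    (solve 6 (λ a x t e X E → a :* (x :+ t :* e) :+ (X :+ t :* E) := (a :* x :+ X) :+ t :* (a :* e :+ E)) refl
      (head a) (head x) t (head e) _ _)

  ⟨⟩-linearˡ : ∀ {d} (a : ℝ^ d) t b x → ⟨ a ⊕ t ⊛ b , x ⟩ ≈ ⟨ a , x ⟩ + t * ⟨ b , x ⟩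
  ⟨⟩-linearˡ a t b x = begin
    ⟨ a ⊕ t ⊛ b , x ⟩          ≈⟨ ⟨⟩-comm (a ⊕ t ⊛ b) x ⟩
    ⟨ x , a ⊕ t ⊛ b ⟩          ≈⟨ ⟨⟩-linearʳ x a t b ⟩
    ⟨ x , a ⟩ + t * ⟨ x , b ⟩  ≈⟨ +-cong (⟨⟩-comm x a) (*-congˡ (⟨⟩-comm x b)) ⟩
    ⟨ a , x ⟩ + t * ⟨ b , x ⟩  ∎

  sum-zero : ∀ {n} (t : Vector Carrier n) → (∀ i → t i ≈ 0#) → sum t ≈ 0#
  sum-zero {n} t t≈0 = trans (sum-cong-≋ t≈0) (sum-replicate-zero n)

  sum-single : ∀ {n} (t : Vector Carrier n) j → (∀ i → j ≢ i → t i ≈ 0#) → sum t ≈ t j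
  sum-single {suc n} t j t≈0 = trans (sum-remove t)
    (trans (+-congˡ (sum-zero _ (λ i → t≈0 _ (λ eq → punchInᵢ≢i j i (≡.sym eq))))) (+-identityʳ _))

  ⟨⟩-zeroˡ : ∀ {d} (a x : ℝ^ d) → (∀ l → a l ≈ 0#) → ⟨ a , x ⟩ ≈ 0#
  ⟨⟩-zeroˡ a x a≈0 = sum-zero _ (λ l → trans (*-congʳ (a≈0 l)) (zeroˡ (x l)))

  ⟨⟩-insertAt : ∀ {d} (a : ℝ^ (suc d)) x k v → ⟨ a , insertAt x k v ⟩ ≈ a k * v + ⟨ removeAt a k , x ⟩
  ⟨⟩-insertAt a x zero v = refl
  ⟨⟩-insertAt {suc d} a x (suc k) v = trans (+-congˡ (⟨⟩-insertAt (tail a) (tail x) k v))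
    (solve 3 (λ a b c → a :+ (b :+ c) := b :+ (a :+ c)) refl _ _ _)

  -- Nontrivial solutions of homogeneous linear systems.

  -- Gaussian elimination on the first row: a zero row is dropped, and otherwise a pivot removes one
  -- equation together with one unknown.
  kernel : ∀ {n m} → n ℕ.< m → (A : Fin n → ℝ^ m) →
    ∃ λ c → (∃ λ i → ¬ c i ≈ 0#) × (∀ j → ⟨ A j , c ⟩ ≈ 0#)
  kernel {zero}  {suc m} _ A = (λ _ → 1#) , (zero , λ 1≈0 → 0#≉1# (sym 1≈0)) , λ ()
  kernel {suc n} {suc m} (ℕ.s≤s n<m) A with em {∃ λ k → ¬ A zero k ≈ 0#}
  ... | no A₀≈0 =
    let c , c≉0 , Ac≈0 = kernel (ℕ.m<n⇒m<1+n n<m) (tail A) in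
    c , c≉0 , λ where
      zero    → ⟨⟩-zeroˡ (A zero) c (λ l → decidable-stable em (λ A₀l≉0 → A₀≈0 (l , A₀l≉0)))
      (suc j) → Ac≈0 j
  ... | yes (k , A₀k≉0) =
    c , (punchIn k i , λ cᵢ≈0 → c′ᵢ≉0 (trans (reflexive (≡.sym (insertAt-punchIn c′ k v i))) cᵢ≈0)) , Ac≈0
    where
    p⁻¹ = proj₁ (inverse (A zero k) A₀k≉0)
    p*p⁻¹≈1 = proj₂ (inverse (A zero k) A₀k≉0)
    A₀ = removeAt (A zero) k
    -- Subtracting this multiple of the first row clears column `k`, which can then be deleted.
    rec = kernel n<m (λ j → removeAt (A (suc j)) k ⊕ (- (A (suc j) k * p⁻¹)) ⊛ A₀)
    c′ = proj₁ rec
    i = proj₁ (proj₁ (proj₂ rec))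
    c′ᵢ≉0 = proj₂ (proj₁ (proj₂ rec))
    -- The value of the deleted unknown, solved from the first equation.
    v = - (p⁻¹ * ⟨ A₀ , c′ ⟩)
    c = insertAt c′ k v
    Ac≈0 : ∀ j → ⟨ A j , c ⟩ ≈ 0#
    Ac≈0 zero = begin
      ⟨ A zero , c ⟩                         ≈⟨ ⟨⟩-insertAt (A zero) c′ k v ⟩
      A zero k * v + ⟨ A₀ , c′ ⟩
        ≈⟨ solve 3 (λ p q s → p :* :- (q :* s) :+ s
              := (con (+ 1) :+ :- (p :* q)) :* s) refl (A zero k) p⁻¹ ⟨ A₀ , c′ ⟩ ⟩
      (1# + - (A zero k * p⁻¹)) * ⟨ A₀ , c′ ⟩  ≈⟨ *-congʳ (+-congˡ (-‿cong p*p⁻¹≈1)) ⟩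
      (1# + - 1#) * ⟨ A₀ , c′ ⟩
        ≈⟨ solve 1 (λ s → (con (+ 1) :+ :- con (+ 1)) :* s := con (+ 0)) refl ⟨ A₀ , c′ ⟩ ⟩
      0#                                     ∎
    Ac≈0 (suc j) = begin
      ⟨ A (suc j) , c ⟩                           ≈⟨ ⟨⟩-insertAt (A (suc j)) c′ k v ⟩
      A (suc j) k * v + ⟨ removeAt (A (suc j)) k , c′ ⟩
        ≈⟨ solve 4 (λ a q s t → a :* :- (q :* s) :+ t := t :+ :- (a :* q) :* s) refl (A (suc j) k) p⁻¹ ⟨ A₀ , c′ ⟩ _ ⟩
      ⟨ removeAt (A (suc j)) k , c′ ⟩ + - (A (suc j) k * p⁻¹) * ⟨ A₀ , c′ ⟩
        ≈⟨ ⟨⟩-linearˡ (removeAt (A (suc j)) k) _ A₀ c′ ⟨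
      ⟨ removeAt (A (suc j)) k ⊕ (- (A (suc j) k * p⁻¹)) ⊛ A₀ , c′ ⟩ ≈⟨ proj₂ (proj₂ rec) j ⟩
      0#                                     ∎

  -- Functionals constant on a set of codimension at most 1.

  ConstantOn : ∀ {d} → Subset d → ℝ^ d → Carrier → Set
  ConstantOn P a b = ∀ x → P x → ⟨ a , x ⟩ ≈ b

  ⟨⟩-combination : ∀ {d m} (a : ℝ^ d) b c (p : Vector (ℝ^ d) m) → (∀ i → ⟨ a , p i ⟩ ≈ b) →
    ⟨ a , combination c p ⟩ ≈ sum c * b
  ⟨⟩-combination {m = zero} a b c p _ = trans (trans (⟨⟩-comm a _) (⟨⟩-zeroˡ _ a (λ _ → refl))) (sym (zeroˡ b))
  ⟨⟩-combination {m = suc m} a b c p ap≈b = begin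
    ⟨ a , combination c p ⟩
      ≈⟨ ⟨⟩-congˡ {a = a} (λ l → +-comm (head c * head p l) (combination (tail c) (tail p) l)) ⟩
    ⟨ a , combination (tail c) (tail p) ⊕ head c ⊛ head p ⟩
      ≈⟨ ⟨⟩-linearʳ a _ (head c) (head p) ⟩
    ⟨ a , combination (tail c) (tail p) ⟩ + head c * ⟨ a , head p ⟩
      ≈⟨ +-cong (⟨⟩-combination a b (tail c) (tail p) (λ i → ap≈b (suc i))) (*-congˡ (ap≈b zero)) ⟩
    sum (tail c) * b + head c * b
      ≈⟨ solve 3 (λ s h b → s :* b :+ h :* b := (h :+ s) :* b) refl (sum (tail c)) (head c) b ⟩
    sum c * b
      ∎

  -- The weights of an affine combination sum to 1, so they reproduce the constant. This carries
  -- equations valid on P over to an affine basis of its hull, whose points need not lie in P.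
  ConstantOn-affineHull : ∀ {d} {P : Subset d} {a b} → ConstantOn P a b → ConstantOn (affineHull P) a b
  ConstantOn-affineHull {a = a} {b} const x (m , c , p , p∈P , sum≈1 , x≋) = begin
    ⟨ a , x ⟩                ≈⟨ ⟨⟩-congˡ {a = a} x≋ ⟩
    ⟨ a , combination c p ⟩  ≈⟨ ⟨⟩-combination a b c p (λ i → const (p i) (p∈P i)) ⟩
    sum c * b                ≈⟨ *-congʳ sum≈1 ⟩
    1# * b                   ≈⟨ *-identityˡ b ⟩
    b                        ∎

  range⊆affineHull : ∀ {d m} (p : Vector (ℝ^ d) m) i → affineHull (range p) (p i)
  range⊆affineHull p i = 1 , (λ _ → 1#) , (λ _ → p i) , (λ _ → i , λ _ → refl) , +-identityʳ 1# ,
    λ l → sym (trans (+-identityʳ _) (*-identityˡ _))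

  -- If b j were nonzero, the equations saying that the coefficients c and the
  -- coordinates other than j and k of Σ cᵢ pᵢ sum to zero would be fewer than
  -- the points p.  A nontrivial solution c then kills coordinate j because of
  -- b, and coordinate k because of a, against affine independence.
  independent-constraints : ∀ {d m} (p : Vector (ℝ^ d) m) → AffinelyIndependent p → d ℕ.≤ m →
    ∀ (a : ℝ^ d) α → (∀ i → ⟨ a , p i ⟩ ≈ α) → ∀ b β → (∀ i → ⟨ b , p i ⟩ ≈ β) →
    ∀ k → ¬ a k ≈ 0# → b k ≈ 0# → ∀ j → b j ≈ 0#
  independent-constraints {suc zero} p ind _ a α ap b β bp zero ak≉0 bk≈0 zero = bk≈0
  independent-constraints {suc (suc n)} {m} p ind d≤m a α ap b β bp k ak≉0 bk≈0 j with em {b j ≈ 0#}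
  ... | yes bj≈0 = bj≈0
  ... | no  bj≉0 = contradiction (ind c sum≈0 X≈0 (proj₁ nontrivial)) (proj₂ nontrivial)
    where
    k≢j : k ≢ j
    k≢j ≡.refl = bj≉0 bk≈0
    row : Fin (suc n) → ℝ^ m
    row zero    i = 1#
    row (suc q) i = p i (punchIn k (punchIn (punchOut k≢j) q))
    -- There are `suc n` equations in m unknowns, and since d is `suc (suc n)`, the hypothesis d ≤ m
    -- is literally `suc n < m`.
    ker = kernel d≤m row
    c = proj₁ ker
    nontrivial = proj₁ (proj₂ ker)
    X = combination c p
    sum≈0 : sum c ≈ 0#
    sum≈0 = trans (sum-cong-≋ (λ i → sym (*-identityˡ (c i)))) (proj₂ (proj₂ ker) zero)
    X-other≈0 : ∀ l → k ≢ l → j ≢ l → X l ≈ 0#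
    X-other≈0 l k≢l j≢l =
      trans (⟨⟩-comm c (λ i → p i l)) (trans (reflexive (≡.cong (λ l → ⟨ (λ i → p i l) , c ⟩) (≡.sym l≡)))
        (proj₂ (proj₂ ker) (suc (punchOut j′≢l′))))
      where
      j′≢l′ : punchOut k≢j ≢ punchOut k≢l
      j′≢l′ eq = j≢l (punchOut-injective k≢j k≢l eq)
      l≡ : punchIn k (punchIn (punchOut k≢j) (punchOut j′≢l′)) ≡ l
      l≡ = ≡.trans (≡.cong (punchIn k) (punchIn-punchOut j′≢l′)) (punchIn-punchOut k≢l)
    ⟨⟩X≈0 : ∀ a α → (∀ i → ⟨ a , p i ⟩ ≈ α) → ⟨ a , X ⟩ ≈ 0#
    ⟨⟩X≈0 a α ap = trans (⟨⟩-combination a α c p ap) (trans (*-congʳ sum≈0) (zeroˡ α))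
    Xj≈0 : X j ≈ 0#
    Xj≈0 = *-zero-divisorˡ bj≉0 (trans (sym (sum-single (λ l → b l * X l) j other)) (⟨⟩X≈0 b β bp))
      where
      other : ∀ l → j ≢ l → b l * X l ≈ 0#
      other l j≢l with k Fin.≟ l
      ... | yes ≡.refl = trans (*-congʳ bk≈0) (zeroˡ (X k))
      ... | no  k≢l    = trans (*-congˡ (X-other≈0 l k≢l j≢l)) (zeroʳ (b l))
    X-≢k≈0 : ∀ l → k ≢ l → X l ≈ 0#
    X-≢k≈0 l k≢l with j Fin.≟ l
    ... | yes ≡.refl = Xj≈0
    ... | no  j≢l    = X-other≈0 l k≢l j≢l
    X≈0 : ∀ l → X l ≈ 0#
    X≈0 l with k Fin.≟ l
    ... | no  k≢l    = X-≢k≈0 l k≢l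
    ... | yes ≡.refl = *-zero-divisorˡ ak≉0 (trans
      (sym (sum-single (λ l → a l * X l) k (λ l k≢l → trans (*-congˡ (X-≢k≈0 l k≢l)) (zeroʳ (a l)))))
      (⟨⟩X≈0 a α ap))

  -- From m + k = d + 1 with k ≤ 1 it follows that m ≥ d, which is the form in which the codimension
  -- enters the linear algebra.
  affineBasis-size : ∀ {d} {P : Subset d} → HasCodimension P 0 ⊎ HasCodimension P 1 →
    ∃ λ m → ∃ λ (p : Vector (ℝ^ d) m) → AffinelyIndependent p × affineHull (range p) ⊆ affineHull P × d ℕ.≤ m
  affineBasis-size (inj₁ (m , p , ind , hull , eq)) = m , p , ind , proj₂ hull ,
    ℕ.≤-trans (ℕ.n≤1+n _) (ℕ.≤-reflexive (≡.trans (≡.sym eq) (ℕ.+-identityʳ m)))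
  affineBasis-size (inj₂ (m , p , ind , hull , eq)) = m , p , ind , proj₂ hull ,
    ℕ.≤-reflexive (ℕ.suc-injective (≡.trans (≡.sym eq) (ℕ.+-comm m 1)))

  -- The functional aₖ b - bₖ a is constant on P and its k-th coefficient vanishes, so by
  -- `independent-constraints` it is zero.
  proportional : ∀ {d} {P : Subset d} → HasCodimension P 0 ⊎ HasCodimension P 1 →
    ∀ {a α b β} → ConstantOn P a α → ConstantOn P b β → ∀ k → ¬ a k ≈ 0# →
    ∀ x → a k * ⟨ b , x ⟩ ≈ b k * ⟨ a , x ⟩
  proportional {P = P} codim {a} {α} {b} {β} aP bP k ak≉0 x = begin
    a k * ⟨ b , x ⟩
      ≈⟨ solve 4 (λ a b A B → a :* B
            := con (+ 0) :+ a :* B :+ :- b :* A :+ b :* A) refl (a k) (b k) ⟨ a , x ⟩ ⟨ b , x ⟩ ⟩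
    0# + a k * ⟨ b , x ⟩ + - b k * ⟨ a , x ⟩ + b k * ⟨ a , x ⟩
      ≈⟨ +-congʳ (⟨e,⟩ x) ⟨
    ⟨ e , x ⟩ + b k * ⟨ a , x ⟩
      ≈⟨ +-congʳ (⟨⟩-zeroˡ e x e≈0) ⟩
    0# + b k * ⟨ a , x ⟩
      ≈⟨ +-identityˡ _ ⟩
    b k * ⟨ a , x ⟩
      ∎
    where
    basis = affineBasis-size {P = P} codim
    p = proj₁ (proj₂ basis)
    ind = proj₁ (proj₂ (proj₂ basis))
    d≤m = proj₂ (proj₂ (proj₂ (proj₂ basis)))
    hull = proj₁ (proj₂ (proj₂ (proj₂ basis)))
    constant : ∀ {a α} → ConstantOn P a α → ∀ i → ⟨ a , p i ⟩ ≈ α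
    constant aP i = ConstantOn-affineHull aP (p i) (hull (range⊆affineHull p i))
    -- The leading zero vector gives both summands the shape that `⟨⟩-linearˡ` expects.
    e = ((λ _ → 0#) ⊕ a k ⊛ b) ⊕ (- b k) ⊛ a
    ⟨e,⟩ : ∀ x → ⟨ e , x ⟩ ≈ 0# + a k * ⟨ b , x ⟩ + - b k * ⟨ a , x ⟩
    ⟨e,⟩ x = trans (⟨⟩-linearˡ ((λ _ → 0#) ⊕ a k ⊛ b) (- b k) a x) (+-congʳ
      (trans (⟨⟩-linearˡ (λ _ → 0#) (a k) b x) (+-congʳ (⟨⟩-zeroˡ (λ _ → 0#) x (λ _ → refl)))))
    e≈0 : ∀ l → e l ≈ 0#
    e≈0 = independent-constraints p ind d≤m a α (constant aP) e (0# + a k * β + - b k * α)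
      (λ i → trans (⟨e,⟩ (p i)) (+-cong (+-congˡ (*-congˡ (constant bP i))) (*-congˡ (constant aP i))))
      k ak≉0 (solve 2 (λ a b → con (+ 0) :+ a :* b :+ :- b :* a := con (+ 0)) refl (a k) (b k))

  -- Density of the points w + ρ z in integral hyperplanes.

  -- The constant is the sum of the |aₗ|; it is chosen before `δ` and `e`, so that radii can be
  -- fitted to it later.
  ∃-Bounded-⟨⟩ : ∀ {d} (a : ℝ^ d) →
    ∃ λ k → 0# ≤ k × (∀ {δ e} → (∀ l → Bounded δ (e l)) → Bounded (k * δ) ⟨ a , e ⟩)
  ∃-Bounded-⟨⟩ {zero} a = 0# , ≤-refl , λ {δ} _ →
    ≤-reflexive (solve 1 (λ δ → :- (con (+ 0) :* δ) := con (+ 0)) refl δ) , ≤-reflexive (sym (zeroˡ δ))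
  ∃-Bounded-⟨⟩ {suc d} a =
    let k , 0≤k , bound = ∃-Bounded-* (head a)
        K , 0≤K , Bound = ∃-Bounded-⟨⟩ (tail a)
    in  k + K , +-nonNeg 0≤k 0≤K , λ {δ} eδ → Bounded-resp
          (solve 3 (λ k K δ → k :* δ :+ K :* δ := (k :+ K) :* δ) refl k K δ) refl
          (Bounded-+ (bound (eδ zero)) (Bound (λ l → eδ (suc l))))

  fromℤ-⟨⟩ : ∀ {d} (a v : Vec ℤ d) → ∃ λ t → fromℤ t ≈ ⟨ fromℤ^ a , fromℤ^ v ⟩
  fromℤ-⟨⟩ []      []      = + 0 , refl
  fromℤ-⟨⟩ (a ∷ as) (v ∷ vs) = let t , t≈ = fromℤ-⟨⟩ as vs in
    a ℤ.* v ℤ.+ t , trans (fromℤ-+ (a ℤ.* v) t) (+-cong (fromℤ-* a v) t≈)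

  ⟨⟩-updateAt : ∀ {d} (a x : ℝ^ d) k t → ⟨ a , updateAt x k (_+ t) ⟩ ≈ ⟨ a , x ⟩ + a k * t
  ⟨⟩-updateAt {suc d} a x zero t =
    solve 4 (λ a x t X → a :* (x :+ t) :+ X := a :* x :+ X :+ a :* t) refl (head a) (head x) t ⟨ tail a , tail x ⟩
  ⟨⟩-updateAt {suc d} a x (suc k) t = trans (+-congˡ (⟨⟩-updateAt (tail a) (tail x) k t))
    (solve 3 (λ a b c → a :+ (b :+ c) := a :+ b :+ c) refl (head a * head x) ⟨ tail a , tail x ⟩ (a (suc k) * t))

  updateAt-cases : ∀ {d} (x : ℝ^ d) k t (S : Fin d → Pred Carrier 0ℓ) →
    (∀ l → S l (x l)) → S k (x k + t) → ∀ l → S l (updateAt x k (_+ t) l)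
  updateAt-cases x k t S Sx Sk l with l Fin.≟ k
  ... | yes ≡.refl = ≡.subst (S k) (≡.sym (updateAt-updates k x)) Sk
  ... | no  l≢k    = ≡.subst (S l) (≡.sym (updateAt-minimal l k x l≢k)) (Sx l)

  -- M makes y = x + M positive, N is a natural number above y / δ, and ρ = y / N.
  small-multiple : ∀ x {δ} → 0# < δ → ∃ λ M → ∃ λ N → ∃ λ ρ → 0# < ρ × ρ ≤ δ × fromℤ N * ρ ≈ x + fromℤ M
  small-multiple x {δ} 0<δ =
    let M , 0<y           = archimedean-+ x 0#
        y                 = x + M · 1#
        δ⁻¹ , 0<δ⁻¹ , inv = positive⇒invertible 0<δ
        N , y/δ<N         = archimedean (y * δ⁻¹)
        0<N               = ≤-<-trans (proj₁ (*-pos 0<y 0<δ⁻¹)) y/δ<N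
        N⁻¹ , 0<N⁻¹ , inv′ = positive⇒invertible 0<N
    in  + M , + N , y * N⁻¹ , *-pos 0<y 0<N⁻¹ ,
        0≤⇒≤ (*-cancelˡ-nonNeg 0<N (≤-resp refl (begin
          δ * (N · 1# + - (y * δ⁻¹))
            ≈⟨ solve 4 (λ δ N y v → δ :* (N :+ :- (y :* v)) := N :* δ :+ :- ((δ :* v) :* y)) refl δ (N · 1#) y δ⁻¹ ⟩
          N · 1# * δ + - (δ * δ⁻¹ * y)
            ≈⟨ +-congˡ (-‿cong (*-congʳ (trans inv (sym inv′)))) ⟩
          N · 1# * δ + - (N · 1# * N⁻¹ * y)
            ≈⟨ solve 4 (λ δ N y v → N :* δ :+ :- ((N :* v) :* y) := N :* (δ :+ :- (y :* v))) refl δ (N · 1#) y N⁻¹ ⟩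
          N · 1# * (δ + - (y * N⁻¹))                ∎) (proj₁ (*-pos 0<δ (<⇒0< y/δ<N))))) ,
        (begin
          N · 1# * (y * N⁻¹)  ≈⟨ solve 3 (λ N y v → N :* (y :* v) := (N :* v) :* y) refl (N · 1#) y N⁻¹ ⟩
          N · 1# * N⁻¹ * y    ≈⟨ *-congʳ inv′ ⟩
          1# * y              ≈⟨ *-identityˡ y ⟩
          y                   ∎)

  OnLatticeLine : ∀ {d} → ℝ^ d → Set
  OnLatticeLine y = ∃ λ w → ∃ λ z → ∃ λ ρ → y ≋ fromℤ^ w ⊕ ρ ⊛ fromℤ^ z

  -- With ρ = (⟨a,x⟩ / aₖ + M) / N, every coordinate but the k-th can be rounded
  -- to a multiple of aₖ ρ, and the k-th is then forced by ⟨a,y⟩ = ⟨a,x⟩ to lie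
  -- in ℤ + ρ ℤ.  Choosing M and then N large makes ρ positive and small.
  lattice-line-dense : ∀ {d} (a : Vec ℤ d) k → ¬ fromℤ^ a k ≈ 0# → ∀ x {δ} → 0# < δ →
    ∃ λ e → (∀ l → Bounded δ (e l)) × ⟨ fromℤ^ a , e ⟩ ≈ 0# × OnLatticeLine (x ⊕ e)
  lattice-line-dense {d} a k ak≉0 x {δ} 0<δ =
    e , e-bounded , ⟨a,e⟩≈0 , tabulate (λ l → proj₁ (line l)) , tabulate (λ l → proj₁ (proj₂ (line l))) , ρ ,
    λ l → trans (proj₂ (proj₂ (line l))) (+-cong
      (reflexive (≡.cong fromℤ (≡.sym (lookup∘tabulate (λ l → proj₁ (line l)) l))))
      (*-congˡ (reflexive (≡.cong fromℤ (≡.sym (lookup∘tabulate (λ l → proj₁ (proj₂ (line l))) l))))))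
    where
    A = fromℤ^ a
    ak = A k
    α = proj₁ (inverse ak ak≉0)
    akα≈1 = proj₂ (inverse ak ak≉0)

    K₁-all = ∃-Bounded-* ak
    K₁ = proj₁ K₁-all
    K₂-all = ∃-Bounded-⟨⟩ A
    K₂ = proj₁ K₂-all
    0≤K = +-nonNeg (proj₁ (proj₂ K₁-all)) (proj₁ (proj₂ K₂-all))
    -- For ρ ≤ δ′, the rounding errors, at most ρ K₁, and the correction of the k-th coordinate, at
    -- most ρ K₂, add up to at most δ.
    δ′-all = ∃-scale< 0≤K 0<δ
    δ′ = proj₁ δ′-all

    ρ-all = small-multiple (⟨ A , x ⟩ * α) (proj₁ (proj₂ δ′-all))
    M = proj₁ ρ-all
    N = proj₁ (proj₂ ρ-all)
    ρ = proj₁ (proj₂ (proj₂ ρ-all))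
    0<ρ = proj₁ (proj₂ (proj₂ (proj₂ ρ-all)))
    ρ≤δ′ = proj₁ (proj₂ (proj₂ (proj₂ (proj₂ ρ-all))))
    Nρ≈ = proj₂ (proj₂ (proj₂ (proj₂ (proj₂ ρ-all))))
    σ-all = positive⇒invertible 0<ρ
    σ = proj₁ σ-all
    ρσ≈1 = proj₂ (proj₂ σ-all)

    -- η is the mesh of the rounding grid and θ its inverse; `f` is the rounding error measured in
    -- units of η.
    η = ak * ρ
    θ = α * σ
    v : Vec ℤ d
    v = tabulate (λ l → proj₁ (round (x l * θ)))
    V = fromℤ^ v
    f : ℝ^ d
    f l = x l * θ + - V l
    f-bounded : ∀ l → Bounded 1# (f l)
    f-bounded l = ≡.subst (λ i → Bounded 1# (x l * θ + - fromℤ i)) (≡.sym (lookup∘tabulate _ l))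
      (proj₂ (round (x l * θ)))
    -- Rounding changes the inner product with `A` by - aₖ ρ ⟨A,f⟩. Because aₖ is a factor of the
    -- mesh, the shift of coordinate k that undoes this is ρ ⟨A,f⟩.
    τ = ρ * ⟨ A , f ⟩
    e : ℝ^ d
    e = updateAt (λ l → - η * f l) k (_+ τ)

    ⟨a,e⟩≈0 : ⟨ A , e ⟩ ≈ 0#
    ⟨a,e⟩≈0 = begin
      ⟨ A , e ⟩
        ≈⟨ ⟨⟩-updateAt A (λ l → - η * f l) k τ ⟩
      ⟨ A , (λ l → - η * f l) ⟩ + ak * τ
        ≈⟨ +-congʳ (⟨⟩-congˡ {a = A} (λ l → sym (+-identityˡ (- η * f l)))) ⟩
      ⟨ A , (λ _ → 0#) ⊕ (- η) ⊛ f ⟩ + ak * τ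
        ≈⟨ +-congʳ (⟨⟩-linearʳ A (λ _ → 0#) (- η) f) ⟩
      ⟨ A , (λ _ → 0#) ⟩ + - η * ⟨ A , f ⟩ + ak * τ
        ≈⟨ +-congʳ (+-congʳ (trans (⟨⟩-comm A (λ _ → 0#)) (⟨⟩-zeroˡ (λ _ → 0#) A (λ _ → refl)))) ⟩
      0# + - (ak * ρ) * ⟨ A , f ⟩ + ak * (ρ * ⟨ A , f ⟩)
        ≈⟨ solve 3 (λ a r F → con (+ 0) :+ :- (a :* r) :* F :+ a :* (r :* F) := con (+ 0)) refl ak ρ ⟨ A , f ⟩ ⟩
      0#
        ∎

    ηf-bounded : ∀ l → Bounded (ρ * K₁) (- η * f l)
    ηf-bounded l = Bounded-resp (solve 2 (λ K r → K :* (r :* con (+ 1)) := r :* K) refl K₁ ρ)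
      (solve 3 (λ a r f → :- (a :* (r :* f)) := :- (a :* r) :* f) refl ak ρ (f l))
      (Bounded-neg (proj₂ (proj₂ K₁-all) (ρ-scale (f-bounded l))))
      where
      ρ-scale : ∀ {x} → Bounded 1# x → Bounded (ρ * 1#) (ρ * x)
      ρ-scale = Bounded-scale (proj₁ 0<ρ)

    total-bound : ρ * K₁ + ρ * K₂ ≤ δ
    total-bound = ≤-trans (≤-from (*-nonNegative 0≤K (≤⇒0≤ ρ≤δ′))
      (solve 4 (λ r r′ K L → r :* K :+ r :* L :+ (K :+ L) :* (r′ :+ :- r) := (K :+ L) :* r′) refl ρ δ′ K₁ K₂))
      (proj₁ (proj₂ (proj₂ δ′-all)))

    e-bounded : ∀ l → Bounded δ (e l)
    e-bounded = updateAt-cases (λ l → - η * f l) k τ (λ _ → Bounded δ)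
      (λ l → Bounded-mono (≤-trans (≤-from (*-nonNegative (proj₁ 0<ρ) (proj₁ (proj₂ K₂-all))) refl) total-bound)
        (ηf-bounded l))
      (Bounded-mono total-bound (Bounded-+ (ηf-bounded k) (Bounded-resp (*-congˡ (*-identityʳ K₂)) refl
        (Bounded-scale (proj₁ 0<ρ) (proj₂ (proj₂ K₂-all) f-bounded)))))

    ηf≈ : ∀ l → x l + - η * f l ≈ η * V l
    ηf≈ l = begin
      x l + - (ak * ρ) * (x l * (α * σ) + - V l)
        ≈⟨ solve 6 (λ x a r α σ v → x :+ :- (a :* r) :* (x :* (α :* σ) :+ :- v)
             := x :+ :- ((a :* α) :* (r :* σ) :* x) :+ a :* r :* v) refl (x l) ak ρ α σ (V l) ⟩
      x l + - (ak * α * (ρ * σ) * x l) + η * V l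
        ≈⟨ +-congʳ (+-congˡ (-‿cong (*-congʳ (*-cong akα≈1 ρσ≈1)))) ⟩
      x l + - (1# * 1# * x l) + η * V l
        ≈⟨ solve 2 (λ x y → x :+ :- (con (+ 1) :* con (+ 1) :* x) :+ y := y) refl (x l) (η * V l) ⟩
      η * V l
        ∎

    t-all = fromℤ-⟨⟩ a v
    t = proj₁ t-all
    -- Since ρ θ = α, τ is α ⟨A,x⟩ - ρ t with t = ⟨a,v⟩ an integer, and the choice of ρ turns α
    -- ⟨A,x⟩ into N ρ - M.
    τ≈ : τ ≈ ρ * (fromℤ N + - fromℤ t) + - fromℤ M
    τ≈ = begin
      ρ * ⟨ A , f ⟩
        ≈⟨ *-congˡ (⟨⟩-congˡ {a = A} (λ l → solve 3 (λ x h v → x :* h :+ :- v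
              := con (+ 0) :+ h :* x :+ :- con (+ 1) :* v) refl (x l) θ (V l))) ⟩
      ρ * ⟨ A , (λ _ → 0#) ⊕ θ ⊛ x ⊕ (- 1#) ⊛ V ⟩
        ≈⟨ *-congˡ (trans (⟨⟩-linearʳ A ((λ _ → 0#) ⊕ θ ⊛ x) (- 1#) V) (+-congʳ (⟨⟩-linearʳ A (λ _ → 0#) θ x))) ⟩
      ρ * (⟨ A , (λ _ → 0#) ⟩ + α * σ * ⟨ A , x ⟩ + - 1# * ⟨ A , V ⟩)
        ≈⟨ *-congˡ (+-cong (+-congʳ (trans (⟨⟩-comm A (λ _ → 0#)) (⟨⟩-zeroˡ (λ _ → 0#) A (λ _ → refl))))
             (*-congˡ (sym (proj₂ t-all)))) ⟩
      ρ * (0# + α * σ * ⟨ A , x ⟩ + - 1# * fromℤ t)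
        ≈⟨ solve 5 (λ r α σ X t → r :* (con (+ 0) :+ α :* σ :* X :+ :- con (+ 1) :* t)
             := (r :* σ) :* (X :* α) :+ :- (r :* t)) refl ρ α σ ⟨ A , x ⟩ (fromℤ t) ⟩
      ρ * σ * (⟨ A , x ⟩ * α) + - (ρ * fromℤ t)
        ≈⟨ +-congʳ (*-congʳ ρσ≈1) ⟩
      1# * (⟨ A , x ⟩ * α) + - (ρ * fromℤ t)
        ≈⟨ solve 3 (λ X m s → con (+ 1) :* X :+ :- s
              := X :+ m :+ :- m :+ :- s) refl (⟨ A , x ⟩ * α) (fromℤ M) (ρ * fromℤ t) ⟩
      ⟨ A , x ⟩ * α + fromℤ M + - fromℤ M + - (ρ * fromℤ t)
        ≈⟨ +-congʳ (+-congʳ Nρ≈) ⟨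
      fromℤ N * ρ + - fromℤ M + - (ρ * fromℤ t)
        ≈⟨ solve 4 (λ n r m t → n :* r :+ :- m :+ :- (r :* t)
              := r :* (n :+ :- t) :+ :- m) refl (fromℤ N) ρ (fromℤ M) (fromℤ t) ⟩
      ρ * (fromℤ N + - fromℤ t) + - fromℤ M
        ∎

    line : ∀ l → ∃ λ w → ∃ λ z → x l + e l ≈ fromℤ w + ρ * fromℤ z
    line = updateAt-cases (λ l → - η * f l) k τ (λ l y → ∃ λ w → ∃ λ z → x l + y ≈ fromℤ w + ρ * fromℤ z)
      -- Away from k the rounded coordinate is an integer multiple of ρ, so w is 0 there.
      (λ l → + 0 , Vec.lookup a k ℤ.* Vec.lookup v l , (begin
        x l + - η * f l
          ≈⟨ ηf≈ l ⟩
        ak * ρ * V l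
          ≈⟨ solve 3 (λ a r v → a :* r :* v := con (+ 0) :+ r :* (a :* v)) refl ak ρ (V l) ⟩
        0# + ρ * (ak * V l)
          ≈⟨ +-congˡ (*-congˡ (fromℤ-* (Vec.lookup a k) (Vec.lookup v l))) ⟨
        0# + ρ * fromℤ (Vec.lookup a k ℤ.* Vec.lookup v l)
          ∎))
      (ℤ.- M , Vec.lookup a k ℤ.* Vec.lookup v k ℤ.+ (N ℤ.+ ℤ.- t) , (begin
        x k + (- η * f k + τ)
          ≈⟨ solve 3 (λ x y z → x :+ (y :+ z) := x :+ y :+ z) refl (x k) (- η * f k) τ ⟩
        x k + - η * f k + τ
          ≈⟨ +-cong (ηf≈ k) τ≈ ⟩
        ak * ρ * V k + (ρ * (fromℤ N + - fromℤ t) + - fromℤ M)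
          ≈⟨ solve 6 (λ a r v n t m → a :* r :* v :+ (r :* (n :+ :- t) :+ :- m) := :- m :+ r :* (a :* v :+ (n :+ :- t)))
               refl ak ρ (V k) (fromℤ N) (fromℤ t) (fromℤ M) ⟩
        - fromℤ M + ρ * (ak * V k + (fromℤ N + - fromℤ t))
          ≈⟨ +-cong (fromℤ-neg M) (*-congˡ (trans (fromℤ-+ (Vec.lookup a k ℤ.* Vec.lookup v k) (N ℤ.+ ℤ.- t))
               (+-cong (fromℤ-* (Vec.lookup a k) (Vec.lookup v k))
                 (trans (fromℤ-+ N (ℤ.- t)) (+-congˡ (fromℤ-neg t)))))) ⟨
        fromℤ (ℤ.- M) + ρ * fromℤ (Vec.lookup a k ℤ.* Vec.lookup v k ℤ.+ (N ℤ.+ ℤ.- t))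
          ∎))

  -- Cardinalities and Ehrhart counts of sparse lattices.

  -- Infinite sets also get the value 0 from `card`, so inhabitation has to be accompanied by
  -- finiteness.
  card-inhabited : ∀ {A : Set} {S : Pred A 0ℓ} {n} → HasCardinality S n → ∀ {x} → S x → card em S ≢ 0
  card-inhabited {S = S} finite {x} Sx with em {∃ (HasCardinality S)}
  ... | no ¬finite = λ _ → ¬finite (_ , finite)
  ... | yes (n , [] , _ , elements , _) = contradiction (Equivalence.from (elements x) Sx) λ ()
  ... | yes (n , _ ∷ _ , _ , _ , ≡.refl) = λ ()

  -- A nonzero value cannot be the default for infinite sets; it comes from a nonempty enumeration.
  inhabited-card : ∀ {A : Set} {S : Pred A 0ℓ} → card em S ≢ 0 → ∃ S
  inhabited-card {S = S} card≢0 with em {∃ (HasCardinality S)}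
  ... | no _ = contradiction ≡.refl card≢0
  ... | yes (n , [] , _ , _ , len) = contradiction (≡.sym len) card≢0
  ... | yes (n , x ∷ _ , _ , elements , _) = x , Equivalence.to (elements x) (here ≡.refl)

  ∃!⇒HasCardinality-1 : ∀ {A : Set} {S : Pred A 0ℓ} {x} → S x → (∀ y → S y → y ≡ x) → HasCardinality S 1
  ∃!⇒HasCardinality-1 {x = x} Sx unique = x ∷ [] , [] ∷ [] ,
    (λ y → mk⇔ (λ { (here ≡.refl) → Sx }) (λ Sy → here (unique y Sy))) , ≡.refl

  no-small-multiple : ∀ {b r} → b < r → ∀ t → Bounded b (r * fromℤ t) → t ≡ + 0
  no-small-multiple b<r (+ zero) _ = ≡.refl
  no-small-multiple {b} {r} b<r (+ suc n) (l , u) = contradiction u (<⇒≱ (<-≤-trans b<r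
    (≤-from (*-nonNegative 0≤r (natural-nonNeg n))
      (solve 2 (λ r n → r :+ r :* n := r :* (con (+ 1) :+ n)) refl r (n · 1#)))))
    where
    -- The sign of `b` is read off from the interval [-b, b] being inhabited.
    0≤b+b : 0# ≤ b + b
    0≤b+b = ≤-resp refl (solve 1 (λ b → b :+ :- :- b := b :+ b) refl b) (≤⇒0≤ (≤-trans l u))
    2b = solve 1 (λ b → b :+ b := (con (+ 1) :+ con (+ 1)) :* b) refl b
    0≤b : 0# ≤ b
    0≤b = *-cancelˡ-nonNeg (+-pos-nonNeg 0<1 (proj₁ 0<1)) (≤-resp refl 2b 0≤b+b)
    0≤r : 0# ≤ r
    0≤r = ≤-trans 0≤b (proj₁ b<r)
    natural-nonNeg : ∀ n → 0# ≤ n · 1#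
    natural-nonNeg zero    = ≤-refl
    natural-nonNeg (suc n) = +-nonNeg (proj₁ 0<1) (natural-nonNeg n)
  no-small-multiple {b} {r} b<r -[1+ n ] bounded = contradiction
    (no-small-multiple b<r (+ suc n) (Bounded-resp refl
      (solve 2 (λ r n → :- (r :* :- n) := r :* n) refl r (suc n · 1#)) (Bounded-neg bounded))) λ ()

  -- The value for S is nonzero, so the equality excludes both the empty set and the default value
  -- for T; finiteness of T need not be known beforehand.
  card-≡⇒∃ : ∀ {A : Set} {S T : Pred A 0ℓ} {x} → S x → (∀ y → S y → y ≡ x) → card em S ≡ card em T → ∃ T
  card-≡⇒∃ Sx unique eq = inhabited-card (λ card≡0 →
    card-inhabited (∃!⇒HasCardinality-1 Sx unique) Sx (≡.trans eq card≡0))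

  -- The affine lattice r ℤᵈ - w meets each of P and Q at most once.  Scaling by
  -- s = r⁻¹ turns this into a count of integer points, from which membership
  -- is read off.
  steep-lattice-⊆ : ∀ {d} {P Q : Subset d} {B r s} → (∀ {x y} → x ≋ y → Q x → Q y) →
    (∀ x → P x → ∀ l → Bounded B (x l)) → (∀ x → Q x → ∀ l → Bounded B (x l)) → B + B < r → r * s ≈ 1# →
    ∀ (w z : Vec ℤ d) → ehrhart em (P +ᵖ fromℤ^ w) s ≡ ehrhart em (Q +ᵖ fromℤ^ w) s →
    ∀ {y} → (∀ l → r * fromℤ^ z l ≈ y l + fromℤ^ w l) → P y → Q y
  steep-lattice-⊆ {d} {P} {Q} {B} {r} {s} Q-resp P-bound Q-bound 2B<r rs≈1 w z same {y} rz≈ Py =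
    conclude (card-≡⇒∃
      {S = latticePoints (s *ᵖ (P +ᵖ fromℤ^ w))} {T = latticePoints (s *ᵖ (Q +ᵖ fromℤ^ w))} {x = z} z∈ (unique P-bound) same)
    where
    unscale : ∀ {u x} → u ≈ s * x → r * u ≈ x
    unscale {u} {x} u≈ = begin
      r * u        ≈⟨ *-congˡ u≈ ⟩
      r * (s * x)  ≈⟨ solve 3 (λ r s x → r :* (s :* x) := (r :* s) :* x) refl r s x ⟩
      r * s * x    ≈⟨ *-congʳ rs≈1 ⟩
      1# * x       ≈⟨ *-identityˡ x ⟩
      x            ∎

    -- Stated for any S in the box: for P it bounds the count by 1, and for Q it identifies the
    -- point that the count provides. Two points of the box differ by at most 2B < r in each
    -- coordinate.
    unique : ∀ {S : Subset d} → (∀ x → S x → ∀ l → Bounded B (x l)) →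
      ∀ u → latticePoints (s *ᵖ (S +ᵖ fromℤ^ w)) u → u ≡ z
    unique S-bound u (x , (q , Sq , x≋) , u≋) =
      ≡.trans (≡.sym (tabulate∘lookup u)) (≡.trans (tabulate-cong u≗z) (tabulate∘lookup z))
      where
      difference : ∀ l → r * fromℤ (Vec.lookup u l ℤ.- Vec.lookup z l) ≈ q l + - y l
      difference l = begin
        r * fromℤ (Vec.lookup u l ℤ.- Vec.lookup z l)
          ≈⟨ *-congˡ (trans (fromℤ-+ (Vec.lookup u l) (ℤ.- Vec.lookup z l)) (+-congˡ (fromℤ-neg (Vec.lookup z l)))) ⟩
        r * (fromℤ^ u l + - fromℤ^ z l)
          ≈⟨ solve 3 (λ r u z → r :* (u :+ :- z) := r :* u :+ :- (r :* z)) refl r (fromℤ^ u l) (fromℤ^ z l) ⟩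
        r * fromℤ^ u l + - (r * fromℤ^ z l)
          ≈⟨ +-cong (trans (unscale (u≋ l)) (x≋ l)) (-‿cong (rz≈ l)) ⟩
        q l + fromℤ^ w l + - (y l + fromℤ^ w l)
          ≈⟨ solve 3 (λ q w y → q :+ w :+ :- (y :+ w) := q :+ :- y) refl (q l) (fromℤ^ w l) (y l) ⟩
        q l + - y l
          ∎
      u≗z : ∀ l → Vec.lookup u l ≡ Vec.lookup z l
      u≗z l = ℤ.i-j≡0⇒i≡j _ _ (no-small-multiple 2B<r (Vec.lookup u l ℤ.- Vec.lookup z l)
        (Bounded-resp refl (sym (difference l)) (Bounded-+ (S-bound q Sq l) (Bounded-neg (P-bound y Py l)))))

    z∈ : latticePoints (s *ᵖ (P +ᵖ fromℤ^ w)) z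
    z∈ = y ⊕ fromℤ^ w , (y , Py , λ _ → refl) , λ l → begin
      fromℤ^ z l               ≈⟨ *-identityˡ _ ⟨
      1# * fromℤ^ z l          ≈⟨ *-congʳ rs≈1 ⟨
      r * s * fromℤ^ z l
        ≈⟨ solve 3 (λ r s z → r :* s :* z := s :* (r :* z)) refl r s (fromℤ^ z l) ⟩
      s * (r * fromℤ^ z l)     ≈⟨ *-congˡ (rz≈ l) ⟩
      s * (y l + fromℤ^ w l)   ∎

    conclude : ∃ (latticePoints (s *ᵖ (Q +ᵖ fromℤ^ w))) → Q y
    conclude (u , u∈@(x , (q , Qq , x≋) , u≋)) = Q-resp q≋y Qq
      where
      q≋y : q ≋ y
      q≋y l = begin
        q l
          ≈⟨ solve 2 (λ q w → q := q :+ w :+ :- w) refl (q l) (fromℤ^ w l) ⟩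
        q l + fromℤ^ w l + - fromℤ^ w l  ≈⟨ +-congʳ (x≋ l) ⟨
        x l + - fromℤ^ w l               ≈⟨ +-congʳ (unscale (u≋ l)) ⟨
        r * fromℤ^ u l + - fromℤ^ w l
          ≡⟨ ≡.cong (λ u → r * fromℤ^ u l + - fromℤ^ w l) (unique Q-bound u u∈) ⟩
        r * fromℤ^ z l + - fromℤ^ w l    ≈⟨ +-congʳ (rz≈ l) ⟩
        y l + fromℤ^ w l + - fromℤ^ w l
          ≈⟨ solve 2 (λ y w → y :+ w :+ :- w := y) refl (y l) (fromℤ^ w l) ⟩
        y l                              ∎

  -- The given bounds may be negative, for instance for an empty set, so the sum of their absolute
  -- values is taken.
  IsBounded-common : ∀ {d} {P Q : Subset d} → IsBounded P → IsBounded Q → ∃ λ B → 0# ≤ B ×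
    (∀ x → P x → ∀ l → Bounded B (x l)) × (∀ x → Q x → ∀ l → Bounded B (x l))
  IsBounded-common (P₀ , P-bound) (Q₀ , Q-bound) =
    let p , 0≤p , _ , P₀≤p = ∃-Bounded P₀
        q , 0≤q , _ , Q₀≤q = ∃-Bounded Q₀
    in  p + q , +-nonNeg 0≤p 0≤q ,
        (λ x Px l → Bounded-mono (≤-trans P₀≤p (≤-from 0≤q refl)) (P-bound x Px l)) ,
        (λ x Qx l → Bounded-mono (≤-trans Q₀≤q (≤-from 0≤p (+-comm q p))) (Q-bound x Qx l))

  lattice-line-⊆ : ∀ {d} {P Q : Subset d} → IsBounded P → IsBounded Q → (∀ {x y} → x ≋ y → Q x → Q y) →
    (∀ (w : Vec ℤ d) s → 0# < s → ehrhart em (P +ᵖ fromℤ^ w) s ≡ ehrhart em (Q +ᵖ fromℤ^ w) s) →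
    ∀ {y} → OnLatticeLine y → P y → Q y
  lattice-line-⊆ {d} P-bounded Q-bounded Q-resp same {y} (w , z , ρ , y≋) =
    let B , 0≤B , P-bound , Q-bound = IsBounded-common P-bounded Q-bounded
        -- Only ρ + K has to be large: y + w′ = (ρ + K) z with w′ = K z - w holds for every K.
        K , 2B<ρ+K                  = archimedean-+ ρ (B + B)
        s , 0<s , rs≈1              = positive⇒invertible (≤-<-trans (+-nonNeg 0≤B 0≤B) 2B<ρ+K)
    in  steep-lattice-⊆ Q-resp P-bound Q-bound 2B<ρ+K rs≈1 (w′ K) z (same (w′ K) s 0<s) (rz≈ K)
    where
    w′ : ℕ → Vec ℤ d
    w′ K = tabulate (λ l → + K ℤ.* Vec.lookup z l ℤ.- Vec.lookup w l)
    w′≈ : ∀ K l → fromℤ^ (w′ K) l ≈ K · 1# * fromℤ^ z l + - fromℤ^ w l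
    w′≈ K l = trans (reflexive (≡.cong fromℤ (lookup∘tabulate (λ l → + K ℤ.* Vec.lookup z l ℤ.- Vec.lookup w l) l)))
      (trans (fromℤ-+ (+ K ℤ.* Vec.lookup z l) (ℤ.- Vec.lookup w l))
        (+-cong (fromℤ-* (+ K) (Vec.lookup z l)) (fromℤ-neg (Vec.lookup w l))))
    rz≈ : ∀ K l → (ρ + K · 1#) * fromℤ^ z l ≈ y l + fromℤ^ (w′ K) l
    rz≈ K l = begin
      (ρ + K · 1#) * fromℤ^ z l
        ≈⟨ solve 4 (λ ρ K z w → (ρ :+ K) :* z
              := w :+ ρ :* z :+ (K :* z :+ :- w)) refl ρ (K · 1#) (fromℤ^ z l) (fromℤ^ w l) ⟩
      fromℤ^ w l + ρ * fromℤ^ z l + (K · 1# * fromℤ^ z l + - fromℤ^ w l)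
        ≈⟨ +-cong (y≋ l) (w′≈ K l) ⟨
      y l + fromℤ^ (w′ K) l
        ∎

  -- Convexity and relative interior points.

  -- Take t = g / (2g + |h|). Then 1 - t is (g + |h|) / (2g + |h|), and t h cannot use up all of g.
  ∃-step : ∀ {g} → 0# < g → ∀ h → ∃ λ t → 0# < t × 0# < 1# + - t × 0# < g + t * h
  ∃-step {g} 0<g h =
    let k , 0≤k , -k≤h , _ = ∃-Bounded h
        0<2g+k = +-pos-nonNeg (+-pos-nonNeg 0<g (proj₁ 0<g)) 0≤k
        v , 0<v , inv = positive⇒invertible 0<2g+k
    in  g * v , *-pos 0<g 0<v , <-resp refl (begin
          (g + k) * v
            ≈⟨ solve 3 (λ g k v → (g :+ k) :* v := (g :+ g :+ k) :* v :+ :- (g :* v)) refl g k v ⟩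
          (g + g + k) * v + - (g * v) ≈⟨ +-congʳ inv ⟩
          1# + - (g * v)           ∎) (*-pos (+-pos-nonNeg 0<g 0≤k) 0<v) ,
        <-resp refl (begin
          g * v * (g + g + (h + - - k))
            ≈⟨ solve 4 (λ g v h k → g :* v :* (g :+ g :+ (h :+ :- :- k))
                  := g :* ((g :+ g :+ k) :* v) :+ g :* v :* h) refl g v h k ⟩
          g * ((g + g + k) * v) + g * v * h  ≈⟨ +-congʳ (trans (*-congˡ inv) (*-identityʳ g)) ⟩
          g + g * v * h                  ∎)
          (*-pos (*-pos 0<g 0<v) (+-pos-nonNeg (+-pos-nonNeg 0<g (proj₁ 0<g)) (≤⇒0≤ -k≤h)))

  Convex : ∀ {d} → Subset d → Set
  Convex P = ∀ {x y t} → 0# ≤ t → 0# ≤ 1# + - t → P x → P y → P (x ⊕ t ⊛ (y ⊕ (- 1#) ⊛ x))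

  ⟨⟩-segment : ∀ {d} (a x y : ℝ^ d) t →
    ⟨ a , x ⊕ t ⊛ (y ⊕ (- 1#) ⊛ x) ⟩ ≈ ⟨ a , x ⟩ + t * (⟨ a , y ⟩ + - ⟨ a , x ⟩)
  ⟨⟩-segment a x y t = trans (⟨⟩-linearʳ a x t (y ⊕ (- 1#) ⊛ x)) (+-congˡ (*-congˡ
    (trans (⟨⟩-linearʳ a y (- 1#) x) (+-congˡ (solve 1 (λ x → :- con (+ 1) :* x := :- x) refl ⟨ a , x ⟩)))))

  -- The slack of a constraint is affine along a segment, so its sign inside follows from the signs
  -- at the two ends.
  segment-gap : ∀ {d} (a x y : ℝ^ d) t b →
    (1# + - t) * (b + - ⟨ a , x ⟩) + t * (b + - ⟨ a , y ⟩) ≈ b + - ⟨ a , x ⊕ t ⊛ (y ⊕ (- 1#) ⊛ x) ⟩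
  segment-gap a x y t b = trans
    (solve 4 (λ t b X Y → (con (+ 1) :+ :- t) :* (b :+ :- X) :+ t :* (b :+ :- Y) := b :+ :- (X :+ t :* (Y :+ :- X)))
      refl t b ⟨ a , x ⟩ ⟨ a , y ⟩)
    (+-congˡ (-‿cong (sym (⟨⟩-segment a x y t))))

  halfspaces-convex : ∀ {d n} (a : Vector (ℝ^ d) n) b → Convex (halfspaces a b)
  halfspaces-convex a b {x} {y} {t} 0≤t 0≤1-t Px Py i = 0≤⇒≤ (≤-resp refl (segment-gap (a i) x y t (b i))
    (+-nonNeg (*-nonNegative 0≤1-t (≤⇒0≤ (Px i))) (*-nonNegative 0≤t (≤⇒0≤ (Py i)))))

  halfspaces-resp : ∀ {d n} (a : Vector (ℝ^ d) n) b {x y} → x ≋ y → halfspaces a b x → halfspaces a b y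
  halfspaces-resp a b x≋y Px i = ≤-resp (⟨⟩-congˡ {a = a i} x≋y) refl (Px i)

  -- The tight constraints are the implicit equalities of P; a point of P strict in all others is a
  -- relative interior point.
  StrictOrTight : ∀ {d} → Subset d → ℝ^ d → Carrier → ℝ^ d → Set
  StrictOrTight P a b c = ⟨ a , c ⟩ < b ⊎ ConstantOn P a b

  -- Induction on the constraints. If the new one is strict at some `u` in P, move `c` towards `u`,
  -- by so little that `α` stays above `β`.
  relative-interior : ∀ {d n} {P : Subset d} → Convex P →
    (a : Vector (ℝ^ d) n) (b : Vector Carrier n) → P ⊆ halfspaces a b →
    ∀ α β {x} → P x → β < ⟨ α , x ⟩ →
    ∃ λ c → P c × β < ⟨ α , c ⟩ × (∀ i → StrictOrTight P (a i) (b i) c)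
  relative-interior {n = zero} convex a b P⊆ α β Px β<αx = _ , Px , β<αx , λ ()
  relative-interior {n = suc n} {P} convex a b P⊆ α β Px β<αx
    with relative-interior convex (tail a) (tail b) (λ Px i → P⊆ Px (suc i)) α β Px β<αx
       | em {∃ λ u → P u × ¬ ⟨ a zero , u ⟩ ≈ b zero}
  ... | c , Pc , β<αc , strict | no tight = c , Pc , β<αc , λ where
          zero    → inj₂ (λ u Pu → decidable-stable em (λ au≉b → tight (u , Pu , au≉b)))
          (suc i) → strict i
  ... | c , Pc , β<αc , strict | yes (u , Pu , au≉b) =
    let t , 0<t , 0<1-t , 0<gap = ∃-step (<⇒0< β<αc) (⟨ α , u ⟩ + - ⟨ α , c ⟩)
    in  c ⊕ t ⊛ (u ⊕ (- 1#) ⊛ c) , convex (proj₁ 0<t) (proj₁ 0<1-t) Pc Pu ,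
        0<⇒< (<-resp refl (trans
          (solve 4 (λ C β t D → C :+ :- β :+ t :* D
                := C :+ t :* D :+ :- β) refl ⟨ α , c ⟩ β t (⟨ α , u ⟩ + - ⟨ α , c ⟩))
          (+-congʳ (sym (⟨⟩-segment α c u t)))) 0<gap) ,
        λ where
          -- The new slack is 1 - t times that at `c` plus t times that at `u`. The new constraint
          -- gets its positive part from `u`, the earlier strict ones get theirs from `c`.
          zero → inj₁ (0<⇒< (<-resp refl (trans (+-comm _ _) (segment-gap (a zero) c u t (b zero)))
            (+-pos-nonNeg (*-pos 0<t (<⇒0< (P⊆ Pu zero , au≉b)))
              (*-nonNegative (proj₁ 0<1-t) (≤⇒0≤ (P⊆ Pc zero))))))
          (suc i) → [ (λ ac<b → inj₁ (0<⇒< (<-resp refl (segment-gap (a (suc i)) c u t (b (suc i)))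
            (+-pos-nonNeg (*-pos 0<1-t (<⇒0< ac<b)) (*-nonNegative (proj₁ 0<t) (≤⇒0≤ (P⊆ Pu (suc i)))))))) ,
            inj₂ ]′ (strict i)

  -- Neighbourhoods on which strict inequalities persist.

  Ball : ∀ {d} → Carrier → ℝ^ d → Set
  Ball δ e = ∀ l → Bounded δ (e l)

  ⟨⟩-⊕ : ∀ {d} (a x e : ℝ^ d) → ⟨ a , x ⊕ e ⟩ ≈ ⟨ a , x ⟩ + ⟨ a , e ⟩
  ⟨⟩-⊕ a x e = begin
    ⟨ a , x ⊕ e ⟩              ≈⟨ ⟨⟩-congˡ {a = a} (λ l → +-congˡ (sym (*-identityˡ (e l)))) ⟩
    ⟨ a , x ⊕ 1# ⊛ e ⟩         ≈⟨ ⟨⟩-linearʳ a x 1# e ⟩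
    ⟨ a , x ⟩ + 1# * ⟨ a , e ⟩  ≈⟨ +-congˡ (*-identityˡ _) ⟩
    ⟨ a , x ⟩ + ⟨ a , e ⟩       ∎

  strict-open : ∀ {d} (a x : ℝ^ d) b → ⟨ a , x ⟩ < b → ∃ λ δ → 0# < δ × (∀ e → Ball δ e → ⟨ a , x ⊕ e ⟩ < b)
  strict-open a x b ax<b =
    let k , 0≤k , bound = ∃-Bounded-⟨⟩ a
        δ , 0<δ , kδ<g = ∃-scale< 0≤k (<⇒0< ax<b)
    in  δ , 0<δ , λ e eδ → 0<⇒< (<-resp refl (begin
          b + - ⟨ a , x ⟩ + - ⟨ a , e ⟩
            ≈⟨ solve 3 (λ b X E → b :+ :- X :+ :- E := b :+ :- (X :+ E)) refl b ⟨ a , x ⟩ ⟨ a , e ⟩ ⟩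
          b + - (⟨ a , x ⟩ + ⟨ a , e ⟩)    ≈⟨ +-congˡ (-‿cong (⟨⟩-⊕ a x e)) ⟨
          b + - ⟨ a , x ⊕ e ⟩              ∎)
          (<⇒0< (≤-<-trans (proj₂ (bound eδ)) kδ<g)))

  common-radius : ∀ {d n} (G : Fin n → Pred (ℝ^ d) 0ℓ) → (∀ i → ∃ λ δ → 0# < δ × (∀ e → Ball δ e → G i e)) →
    ∃ λ δ → 0# < δ × (∀ e → Ball δ e → ∀ i → G i e)
  common-radius {n = zero}  G radius = 1# , 0<1 , λ _ _ ()
  common-radius {n = suc n} G radius
    with radius zero | common-radius (tail G) (λ i → radius (suc i))
  ... | δ , 0<δ , G₀ | δ′ , 0<δ′ , G₊ with total δ δ′
  ...   | inj₁ δ≤δ′ = δ , 0<δ , λ where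
            e eδ zero    → G₀ e eδ
            e eδ (suc i) → G₊ e (λ l → Bounded-mono δ≤δ′ (eδ l)) i
  ...   | inj₂ δ′≤δ = δ′ , 0<δ′ , λ where
            e eδ zero    → G₀ e (λ l → Bounded-mono δ′≤δ (eδ l))
            e eδ (suc i) → G₊ e eδ i

  -- Comparison of the two polytopes.

  -- By `proportional`, one nonzero normal among the tight constraints determines all the others up
  -- to a factor, so moving inside its hyperplane preserves every implicit equality.
  tight-direction : ∀ {d n} {P : Subset (suc d)} → HasCodimension P 0 ⊎ HasCodimension P 1 →
    (a : Vector (Vec ℤ (suc d)) n) (b : Vector Carrier n) →
    ∃ λ (a₀ : Vec ℤ (suc d)) → ∃ λ k → ¬ fromℤ^ a₀ k ≈ 0# ×
      (∀ i → ConstantOn P (fromℤ^ (a i)) (b i) → ∀ e → ⟨ fromℤ^ a₀ , e ⟩ ≈ 0# → ⟨ fromℤ^ (a i) , e ⟩ ≈ 0#)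
  tight-direction {d} {n} {P} codim a b
    with em {∃ λ i → ConstantOn P (fromℤ^ (a i)) (b i) × ∃ λ k → ¬ fromℤ^ (a i) k ≈ 0#}
  ... | yes (i , aᵢ-tight , k , aᵢk≉0) = a i , k , aᵢk≉0 , λ j aⱼ-tight e aᵢe≈0 →
          *-zero-divisorˡ aᵢk≉0 (trans
            (proportional codim {a = fromℤ^ (a i)} {b = fromℤ^ (a j)} aᵢ-tight aⱼ-tight k aᵢk≉0 e)
            (trans (*-congˡ aᵢe≈0) (zeroʳ _)))
  -- All tight normals vanish, so any nonzero integral normal serves; the all-ones vector is taken.
  ... | no none = Vec.replicate _ (+ 1) , zero , (λ 1≈0 → 0#≉1# (sym (trans (sym (+-identityʳ 1#)) 1≈0))) ,
          λ i aᵢ-tight e _ → ⟨⟩-zeroˡ (fromℤ^ (a i)) e (λ k →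
            decidable-stable em (λ aᵢk≉0 → none (i , aᵢ-tight , k , aᵢk≉0)))

  ehrhart-⊆ : ∀ {d} {P Q : Subset d} → IsBounded P → IsBounded Q → IsSemiRational P → IsSemiRational Q →
    HasCodimension P 0 ⊎ HasCodimension P 1 →
    (∀ (w : Vec ℤ d) s → 0# < s → ehrhart em (P +ᵖ fromℤ^ w) s ≡ ehrhart em (Q +ᵖ fromℤ^ w) s) → P ⊆ Q
  -- In dimension 0 there is no nonzero normal to apply density to, but the only point is trivially
  -- of the form w + ρ z.
  ehrhart-⊆ {zero} P-bounded Q-bounded _ (_ , a′ , b′ , Q⊆H , H⊆Q) _ same =
    lattice-line-⊆ P-bounded Q-bounded
      (λ x≋y Qx → H⊆Q (halfspaces-resp (Vector.map fromℤ^ a′) b′ x≋y (Q⊆H Qx))) same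
      ([] , [] , 0# , λ ())
  ehrhart-⊆ {suc d} {P} {Q} P-bounded Q-bounded (n , a , b , P⊆H , H⊆P) (n′ , a′ , b′ , Q⊆H , H⊆Q)
    codim same {x} Px =
    H⊆Q (λ j → decidable-stable em (λ a′x≰b′ →
      not-separated (fromℤ^ (a′ j)) (b′ j) (λ Qy → Q⊆H Qy j) (≰⇒> a′x≰b′)))
    where
    agree : ∀ {y} → OnLatticeLine y → P y → Q y
    agree = lattice-line-⊆ P-bounded Q-bounded
      (λ x≋y Qx → H⊆Q (halfspaces-resp (Vector.map fromℤ^ a′) b′ x≋y (Q⊆H Qx))) same

    P-convex : Convex P
    P-convex {x} {y} {t} 0≤t 0≤1-t Px Py =
      H⊆P (halfspaces-convex (Vector.map fromℤ^ a) b {x} {y} {t} 0≤t 0≤1-t (P⊆H Px) (P⊆H Py))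

    not-separated : ∀ α β → (∀ {y} → Q y → ⟨ α , y ⟩ ≤ β) → ¬ (β < ⟨ α , x ⟩)
    not-separated α β Q≤β β<αx = <⇒≱ β<αy (Q≤β (agree on-line (H⊆P y∈H)))
      where
      interior = relative-interior P-convex (Vector.map fromℤ^ a) b P⊆H α β Px β<αx
      c = proj₁ interior
      Pc = proj₁ (proj₂ interior)
      direction = tight-direction {P = P} codim a b
      a₀ = proj₁ direction
      tight = proj₂ (proj₂ (proj₂ direction))

      Good : Fin n → Pred (ℝ^ (suc d)) 0ℓ
      -- Each constraint has to survive only displacements inside the hyperplane direction of a₀:
      -- strict ones survive small displacements, tight ones stay equalities for a displacement of
      -- any size.
      Good i e = ⟨ fromℤ^ a₀ , e ⟩ ≈ 0# → ⟨ fromℤ^ (a i) , c ⊕ e ⟩ ≤ b i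
      good : ∀ i → ∃ λ δ → 0# < δ × (∀ e → Ball δ e → Good i e)
      good i with proj₂ (proj₂ (proj₂ interior)) i
      ... | inj₁ ac<b = let δ , 0<δ , inside = strict-open (fromℤ^ (a i)) c (b i) ac<b
                        in  δ , 0<δ , λ e eδ _ → proj₁ (inside e eδ)
      ... | inj₂ aᵢ-tight = 1# , 0<1 , λ e _ a₀e≈0 → ≤-reflexive (begin
              ⟨ fromℤ^ (a i) , c ⊕ e ⟩
                ≈⟨ ⟨⟩-⊕ (fromℤ^ (a i)) c e ⟩
              ⟨ fromℤ^ (a i) , c ⟩ + ⟨ fromℤ^ (a i) , e ⟩
                ≈⟨ +-cong (aᵢ-tight c Pc) (tight i aᵢ-tight e a₀e≈0) ⟩
              b i + 0#
                ≈⟨ +-identityʳ (b i) ⟩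
              b i
                ∎)

      -- Negation turns β < ⟨α,c⟩ into an upper bound, the form that `strict-open` handles.
      -α = (λ _ → 0#) ⊕ (- 1#) ⊛ α
      ⟨-α,⟩ : ∀ y → ⟨ -α , y ⟩ ≈ - ⟨ α , y ⟩
      ⟨-α,⟩ y = trans (⟨⟩-linearˡ (λ _ → 0#) (- 1#) α y) (trans (+-congʳ (⟨⟩-zeroˡ (λ _ → 0#) y (λ _ → refl)))
        (solve 1 (λ x → con (+ 0) :+ :- con (+ 1) :* x := :- x) refl ⟨ α , y ⟩))
      neg-gap : ∀ {x y} → - y + - - x ≈ x + - y
      neg-gap {x} {y} = solve 2 (λ x y → :- y :+ :- :- x := x :+ :- y) refl x y
      α-radius = strict-open -α c (- β) (<-resp (sym (⟨-α,⟩ c)) refl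
        (0<⇒< (<-resp refl (sym neg-gap) (<⇒0< (proj₁ (proj₂ (proj₂ interior)))))))

      -- Index `zero` holds the separation from Q, the remaining indices the constraints of P.
      radius = common-radius
        {n = suc n} (λ { zero e → ⟨ -α , c ⊕ e ⟩ < - β ; (suc i) → Good i })
        (λ { zero → α-radius ; (suc i) → good i })
      dense = lattice-line-dense a₀ (proj₁ (proj₂ direction)) (proj₁ (proj₂ (proj₂ direction))) c
        (proj₁ (proj₂ radius))
      e = proj₁ dense
      on-line = proj₂ (proj₂ (proj₂ dense))
      in-radius = proj₂ (proj₂ radius) e (proj₁ (proj₂ dense))

      y∈H : halfspaces (Vector.map fromℤ^ a) b (c ⊕ e)
      y∈H i = in-radius (suc i) (proj₁ (proj₂ (proj₂ dense)))
      β<αy : β < ⟨ α , c ⊕ e ⟩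
      β<αy = 0<⇒< (<-resp refl neg-gap (<⇒0< (<-resp (⟨-α,⟩ (c ⊕ e)) refl (in-radius zero))))

theorem4 : (em : ExcludedMiddle 0ℓ) (ℝ : CompleteOrderedField) →
  let open CompleteOrderedField ℝ
      open Geometry ℝ in
  (d : ℕ) (P Q : Subset d) →
  IsPolytope P → IsSemiRational P →
  IsPolytope Q → IsSemiRational Q →
  HasCodimension P 0 ⊎ HasCodimension P 1 →
  HasCodimension Q 0 ⊎ HasCodimension Q 1 →
  (∀ (w : Vec ℤ d) (s : Carrier) → 0# < s →
    ehrhart em (P +ᵖ fromℤ^ w) s ≡ ehrhart em (Q +ᵖ fromℤ^ w) s) →
  P ≐ Q
theorem4 em ℝ d P Q (P-bounded , _) P-semirational (Q-bounded , _) Q-semirational P-codim Q-codim same =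
  ehrhart-⊆ em ℝ P-bounded Q-bounded P-semirational Q-semirational P-codim same ,
  ehrhart-⊆ em ℝ Q-bounded P-bounded Q-semirational P-semirational Q-codim (λ w s 0<s → ≡.sym (same w s 0<s))
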